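{- Let $p$ be a prime, $q=p^l$, $n\ge 2$ and $k\ge1$ integers, and suppose $\gcd(k,q-1)=1$. Then: (a) If $q=3$ and $3\nmid k$, then every matrix in $M_n(\mathbb F_q)$ is of the form $A^k+B^k$ with $A,B\in GL_n(\mathbb F_q)$. (b) If $q\ge 3$, then every matrix in $M_n(\mathbb F_q)$ is of the form $A^k+B^k$ with $A,B\in M_n(\mathbb F_q)$ split semisimple. (c) If $q\ge 4$, then every matrix in $M_n(\mathbb F_q)$ is of the form $A^k+B^k$ with $A,B\in GL_n(\mathbb F_q)$ split semisimple.
   Context: A matrix over a field $K$ is split semisimple (diagonalizable) if its minimal polynomial is a product of distinct monic polynomials of degree $1$ in $K[x]$. -}

module Defs where

open import Level using (Level; _⊔_; Lift)
open import Data.Empty using (⊥)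
open import Algebra.Bundles using (CommutativeRing)
open import Data.Nat as ℕ using (ℕ; zero; _<_; _≤_; _∸_)
open import Data.Fin as Fin using (Fin)
open import Data.List using (List; []; _∷_; length)
open import Data.List.Relation.Unary.AllPairs using (AllPairs)
open import Data.Product using (Σ; ∃; _×_; _,_)
open import Relation.Nullary using (¬_)
open import Relation.Binary.PropositionalEquality using (_≡_)

record Field (c ℓ : Level) : Set (Level.suc (c ⊔ ℓ)) where
  field
    commutativeRing : CommutativeRing c ℓ
  open CommutativeRing commutativeRing public
  field
    0≉1     : ¬ (0# ≈ 1#)
    inverse : ∀ x → ¬ (x ≈ 0#) → Σ Carrier λ y → x * y ≈ 1#

HasCard : ∀ {c ℓ} → Field c ℓ → ℕ → Set (c ⊔ ℓ)
HasCard F q =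
  Σ (Fin q → Carrier) λ e →
    (∀ i j → e i ≈ e j → i ≡ j) × (∀ x → ∃ λ i → e i ≈ x)
  where open Field F

module MatrixOps {c ℓ} (F : Field c ℓ) where
  open Field F

  Mat : ℕ → Set c
  Mat n = Fin n → Fin n → Carrier

  infix  4 _≈ᴹ_
  infixl 6 _+ᴹ_
  infixl 7 _*ᴹ_ _·ᴹ_
  infixr 8 _^ᴹ_

  _≈ᴹ_ : ∀ {n} → Mat n → Mat n → Set ℓ
  A ≈ᴹ B = ∀ i j → A i j ≈ B i j

  Σ[_] : ∀ {m} → (Fin m → Carrier) → Carrier
  Σ[_] {zero}    f = 0#
  Σ[_] {ℕ.suc m} f = f Fin.zero + Σ[_] (λ i → f (Fin.suc i))

  δ : ∀ {n} → Fin n → Fin n → Carrier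
  δ Fin.zero    Fin.zero    = 1#
  δ Fin.zero    (Fin.suc j) = 0#
  δ (Fin.suc i) Fin.zero    = 0#
  δ (Fin.suc i) (Fin.suc j) = δ i j

  I : ∀ {n} → Mat n
  I = δ

  O : ∀ {n} → Mat n
  O _ _ = 0#

  _+ᴹ_ : ∀ {n} → Mat n → Mat n → Mat n
  (A +ᴹ B) i j = A i j + B i j

  _*ᴹ_ : ∀ {n} → Mat n → Mat n → Mat n
  (A *ᴹ B) i j = Σ[ (λ k → A i k * B k j) ]

  _·ᴹ_ : ∀ {n} → Carrier → Mat n → Mat n
  (a ·ᴹ A) i j = a * A i j

  _^ᴹ_ : ∀ {n} → Mat n → ℕ → Mat n
  A ^ᴹ zero    = I
  A ^ᴹ ℕ.suc k = A *ᴹ (A ^ᴹ k)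

  Invertible : ∀ {n} → Mat n → Set (c ⊔ ℓ)
  Invertible {n} A = Σ (Mat n) λ B → (A *ᴹ B ≈ᴹ I) × (B *ᴹ A ≈ᴹ I)

  -- Polynomials in F[x], as coefficient lists, lowest degree first.
  Poly : Set c
  Poly = List Carrier

  evalᴹ : ∀ {n} → Poly → Mat n → Mat n
  evalᴹ []       A = O
  evalᴹ (a ∷ cs) A = (a ·ᴹ I) +ᴹ (A *ᴹ evalᴹ cs A)

  shift : Poly → Poly
  shift cs = 0# ∷ cs

  scale : Carrier → Poly → Poly
  scale a []       = []
  scale a (b ∷ cs) = a * b ∷ scale a cs

  _+ᴾ_ : Poly → Poly → Poly
  []       +ᴾ ds       = ds
  (c ∷ cs) +ᴾ []       = c ∷ cs
  (c ∷ cs) +ᴾ (d ∷ ds) = (c + d) ∷ (cs +ᴾ ds)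

  mulLinear : Carrier → Poly → Poly
  mulLinear λ' p = shift p +ᴾ scale (- λ') p

  prodLinear : List Carrier → Poly
  prodLinear []        = 1# ∷ []
  prodLinear (λ' ∷ λs) = mulLinear λ' (prodLinear λs)

  evalVec : ∀ {n m} → (Fin m → Carrier) → Mat n → Mat n
  evalVec {m = zero}    c A = O
  evalVec {m = ℕ.suc m} c A =
    (c Fin.zero ·ᴹ I) +ᴹ (A *ᴹ evalVec (λ i → c (Fin.suc i)) A)

  Monic : Poly → Set ℓ
  Monic []           = Lift ℓ ⊥
  Monic (a ∷ [])     = a ≈ 1#
  Monic (a ∷ b ∷ cs) = Monic (b ∷ cs)

  -- μ is the minimal polynomial of A: μ is monic, μ(A) = 0, and no nonzero
  -- polynomial of degree < deg μ annihilates A (a polynomial of degree < deg μ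
  -- is given by m ≤ deg μ coefficients c₀..c_{m-1}).
  IsMinimalPolynomial : ∀ {n} → Mat n → Poly → Set (c ⊔ ℓ)
  IsMinimalPolynomial {n} A μ =
    Monic μ × (evalᴹ μ A ≈ᴹ O) ×
    (∀ {m} → m ≤ length μ ∸ 1 → (cs : Fin m → Carrier) →
       evalVec cs A ≈ᴹ O → ∀ i → cs i ≈ 0#)

  SplitSemisimple : ∀ {n} → Mat n → Set (c ⊔ ℓ)
  SplitSemisimple A =
    Σ (List Carrier) λ λs →
      AllPairs (λ a b → ¬ (a ≈ b)) λs × IsMinimalPolynomial A (prodLinear λs)

{-# OPTIONS --safe #-}
module Submission where

open import Defs
open import Level using (_⊔_)
open import Data.Nat using (ℕ; zero; suc; _^_; _∸_; _≤_; _<_; s≤s; z≤n)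
import Data.Nat as ℕ
import Data.Nat.Properties as ℕ
open import Data.Nat.Divisibility using (_∣_; divides; ∣1⇒≡1; ∣-refl)
open import Data.Nat.DivMod using (_/_; _%_; m≡m%n+[m/n]*n; m%n<n)
open import Data.Nat.Tactic.RingSolver using (solve-∀)
open import Data.Nat.Primality using (Prime)
open import Data.Nat.GCD using (gcd; gcd-GCD; gcd-greatest; GCD; module Bézout)
open import Data.Bool using (Bool; true; false; not)
open import Data.Fin using (Fin; zero; suc; toℕ; inject₁; fromℕ; opposite; punchIn; punchOut)
open import Data.Fin.Permutation using (Permutation; permutation; remove; punchIn-permute; _⟨$⟩ʳ_)
import Data.Fin.Properties as Fin
open import Data.Fin.Relation.Unary.Top using (view; ‵fromℕ; ‵inject₁)
open import Data.List using ([]; _∷_; length; lookup; filter; tabulate)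
open import Data.List.Membership.Propositional.Properties using (∈-filter⁺; ∈-tabulate⁺)
open import Data.List.Relation.Unary.All as All using (All; []; _∷_)
open import Data.List.Relation.Unary.All.Properties using (all-filter; ¬Any⇒All¬)
open import Data.List.Relation.Unary.AllPairs using (AllPairs; []; _∷_)
import Data.List.Relation.Unary.AllPairs.Properties as AllPairs
open import Data.List.Relation.Unary.Any as Any using (Any; here; there)
open import Data.List.Relation.Unary.Any.Properties using (lookup-index)
open import Data.Product using (Σ; ∃; _×_; _,_; proj₁; proj₂)
open import Data.Sum using (_⊎_; inj₁; inj₂; swap) renaming ([_,_] to ⊎-elim; [_,_]′ to ⊎-rec)
open import Data.Sum.Properties as Sum using (swap-involutive)
open import Data.Unit using (⊤; tt)
open import Function using (_∘_)
open import Relation.Binary using (Setoid)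
open import Relation.Binary.Definitions using (Decidable; DecidableEquality)
open import Relation.Binary.PropositionalEquality as ≡ using (_≡_; _≢_)
import Relation.Binary.Reasoning.Setoid as SetoidReasoning
open import Relation.Nullary using (¬_; Dec; yes; no; contradiction)
open import Relation.Nullary.Decidable using (map′; _⊎-dec_; ¬?; decidable-stable)

-- Every matrix is, up to similarity and transposition, a direct sum of
-- companion matrices. Indeed, take the Krylov chain of a vector, of length m
-- say. If it does not span an invariant subspace, it can be prolonged. If it
-- does, the off-diagonal block coupling it to a complement can be cleared
-- except for one row; if that row vanishes the matrix splits, and otherwise
-- the transpose has a Krylov chain of length m + 1.
--
-- With the vectors of the chain listed backwards, a companion matrix is
--     ( d 1         )
--     ( u   0 1     )
--     (       0 1   )
--     (         …   )
-- with (d, u) in the first column. Write it as A + B, where A has diagonal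
-- a₀, α, α′, α, α′, … and B has diagonal b₀, −α, −α′, −α, −α′, …, with
-- a₀ + b₀ = d, the entries 1 go alternately to A and B, and u goes to B. If
-- a₀ ≠ α ≠ α′ then A is diagonalizable, and if −b₀ differs from α and α′ so is
-- B; q ≥ 3 (q ≥ 4 if 0 is to be avoided) leaves room for such a choice.
-- As x ↦ xᵏ is onto, diagonalizable matrices have diagonalizable k-th roots.
-- Over 𝔽₃ take a₀, b₀ = ±1, α = −a₀ and α′ = a₀: then A² = 1 and B⁶ = 1, and
-- a matrix of order dividing 6 is its own k²-th power.

-- Index sets closed under disjoint union, so that block matrices are
-- matrices indexed by a union.
data Ix : Set where
  𝟙   : Ix
  fin : ℕ → Ix
  _⊕_ : Ix → Ix → Ix

El : Ix → Set
El 𝟙       = ⊤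
El (fin n) = Fin n
El (a ⊕ b) = El a ⊎ El b

_≟_ : ∀ {a} → DecidableEquality (El a)
_≟_ {𝟙}     i j = yes ≡.refl
_≟_ {fin n} i j = i Fin.≟ j
_≟_ {a ⊕ b} i j = Sum.≡-dec (_≟_ {a}) (_≟_ {b}) i j

module Matrices {c ℓ} (F : Field c ℓ) where
  open Field F hiding (zero)
  open MatrixOps F using (Σ[_]; δ)
  open import Algebra.Properties.CommutativeSemigroup +-commutativeSemigroup
    using (interchange; x∙yz≈y∙xz)
  open import Algebra.Properties.CommutativeSemigroup *-commutativeSemigroup
    using () renaming (x∙yz≈y∙xz to x*yz≈y*xz)
  open import Algebra.Properties.Ring ring using (-‿distribˡ-*; x∙y⁻¹≈ε⇒x≈y)
  open import Algebra.Properties.Semiring.Exp semiring public using () renaming (_^_ to _^ᶠ_)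
  module ≈-Reasoning = SetoidReasoning setoid

  -- Sums over index sets

  ∑ : ∀ a → (El a → Carrier) → Carrier
  ∑ 𝟙       f = f tt
  ∑ (fin n) f = Σ[ f ]
  ∑ (a ⊕ b) f = ∑ a (f ∘ inj₁) + ∑ b (f ∘ inj₂)

  ∑-cong : ∀ a {f g : El a → Carrier} → (∀ i → f i ≈ g i) → ∑ a f ≈ ∑ a g
  ∑-cong 𝟙             eq = eq tt
  ∑-cong (fin zero)    eq = refl
  ∑-cong (fin (suc n)) eq = +-cong (eq zero) (∑-cong (fin n) (eq ∘ suc))
  ∑-cong (a ⊕ b)       eq = +-cong (∑-cong a (eq ∘ inj₁)) (∑-cong b (eq ∘ inj₂))

  ∑-zero : ∀ a {f : El a → Carrier} → (∀ i → f i ≈ 0#) → ∑ a f ≈ 0#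
  ∑-zero 𝟙             eq = eq tt
  ∑-zero (fin zero)    eq = refl
  ∑-zero (fin (suc n)) eq = trans (+-cong (eq zero) (∑-zero (fin n) (eq ∘ suc))) (+-identityˡ _)
  ∑-zero (a ⊕ b)       eq =
    trans (+-cong (∑-zero a (eq ∘ inj₁)) (∑-zero b (eq ∘ inj₂))) (+-identityˡ _)

  ∑-+ : ∀ a (f g : El a → Carrier) → ∑ a (λ i → f i + g i) ≈ ∑ a f + ∑ a g
  ∑-+ 𝟙             f g = refl
  ∑-+ (fin zero)    f g = sym (+-identityˡ _)
  ∑-+ (fin (suc n)) f g =
    trans (+-congˡ (∑-+ (fin n) (f ∘ suc) (g ∘ suc))) (interchange _ _ _ _)
  ∑-+ (a ⊕ b)       f g =
    trans (+-cong (∑-+ a (f ∘ inj₁) (g ∘ inj₁)) (∑-+ b (f ∘ inj₂) (g ∘ inj₂)))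
          (interchange _ _ _ _)

  ∑-*ˡ : ∀ a x (f : El a → Carrier) → x * ∑ a f ≈ ∑ a (λ i → x * f i)
  ∑-*ˡ 𝟙             x f = refl
  ∑-*ˡ (fin zero)    x f = zeroʳ x
  ∑-*ˡ (fin (suc n)) x f = trans (distribˡ _ _ _) (+-congˡ (∑-*ˡ (fin n) x (f ∘ suc)))
  ∑-*ˡ (a ⊕ b)       x f =
    trans (distribˡ _ _ _) (+-cong (∑-*ˡ a x (f ∘ inj₁)) (∑-*ˡ b x (f ∘ inj₂)))

  ∑-*ʳ : ∀ a x (f : El a → Carrier) → ∑ a f * x ≈ ∑ a (λ i → f i * x)
  ∑-*ʳ a x f =
    trans (*-comm _ _) (trans (∑-*ˡ a x f) (∑-cong a λ i → *-comm _ _))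

  ∑-swap : ∀ a b (f : El a → El b → Carrier) → ∑ a (λ i → ∑ b (f i)) ≈ ∑ b (λ j → ∑ a (λ i → f i j))
  ∑-swap 𝟙             b f = refl
  ∑-swap (fin zero)    b f = sym (∑-zero b λ _ → refl)
  ∑-swap (fin (suc n)) b f =
    trans (+-congˡ (∑-swap (fin n) b (f ∘ suc))) (sym (∑-+ b _ _))
  ∑-swap (a ⊕ a')      b f =
    trans (+-cong (∑-swap a b (f ∘ inj₁)) (∑-swap a' b (f ∘ inj₂))) (sym (∑-+ b _ _))

  Δ : ∀ a → El a → El a → Carrier
  Δ 𝟙       _        _        = 1#
  Δ (fin n) i        j        = δ i j
  Δ (a ⊕ b) (inj₁ i) (inj₁ j) = Δ a i j
  Δ (a ⊕ b) (inj₁ i) (inj₂ j) = 0#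
  Δ (a ⊕ b) (inj₂ i) (inj₁ j) = 0#
  Δ (a ⊕ b) (inj₂ i) (inj₂ j) = Δ b i j

  Δ-refl : ∀ a i → Δ a i i ≈ 1#
  Δ-refl 𝟙             i        = refl
  Δ-refl (fin (suc n)) zero     = refl
  Δ-refl (fin (suc n)) (suc i)  = Δ-refl (fin n) i
  Δ-refl (a ⊕ b)       (inj₁ i) = Δ-refl a i
  Δ-refl (a ⊕ b)       (inj₂ i) = Δ-refl b i

  Δ-≢ : ∀ a {i j} → i ≢ j → Δ a i j ≈ 0#
  Δ-≢ 𝟙             ne = contradiction ≡.refl ne
  Δ-≢ (fin (suc n)) {zero}   {zero}   ne = contradiction ≡.refl ne
  Δ-≢ (fin (suc n)) {zero}   {suc j}  ne = refl
  Δ-≢ (fin (suc n)) {suc i}  {zero}   ne = refl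
  Δ-≢ (fin (suc n)) {suc i}  {suc j}  ne = Δ-≢ (fin n) (ne ∘ ≡.cong suc)
  Δ-≢ (a ⊕ b)       {inj₁ i} {inj₁ j} ne = Δ-≢ a (ne ∘ ≡.cong inj₁)
  Δ-≢ (a ⊕ b)       {inj₁ i} {inj₂ j} ne = refl
  Δ-≢ (a ⊕ b)       {inj₂ i} {inj₁ j} ne = refl
  Δ-≢ (a ⊕ b)       {inj₂ i} {inj₂ j} ne = Δ-≢ b (ne ∘ ≡.cong inj₂)

  Δ-iff : ∀ a b {i j k l} → (i ≡ j → k ≡ l) → (k ≡ l → i ≡ j) → Δ a i j ≈ Δ b k l
  Δ-iff a b {i} {j} {k} {l} f g with _≟_ {a} i j
  ... | yes ≡.refl = trans (Δ-refl a i)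
                       (≡.subst (λ l → 1# ≈ Δ b k l) (f ≡.refl) (sym (Δ-refl b k)))
  ... | no  i≢j    = trans (Δ-≢ a i≢j) (sym (Δ-≢ b (i≢j ∘ g)))

  Δ-sym : ∀ a i j → Δ a i j ≈ Δ a j i
  Δ-sym a i j = Δ-iff a a ≡.sym ≡.sym

  ∑-Δˡ : ∀ a i (f : El a → Carrier) → ∑ a (λ k → Δ a i k * f k) ≈ f i
  ∑-Δˡ 𝟙             i        f = *-identityˡ _
  ∑-Δˡ (fin (suc n)) zero     f =
    trans (+-cong (*-identityˡ _) (∑-zero (fin n) λ k → zeroˡ _)) (+-identityʳ _)
  ∑-Δˡ (fin (suc n)) (suc i)  f =
    trans (+-cong (zeroˡ _) (∑-Δˡ (fin n) i (f ∘ suc))) (+-identityˡ _)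
  ∑-Δˡ (a ⊕ b)       (inj₁ i) f =
    trans (+-cong (∑-Δˡ a i (f ∘ inj₁)) (∑-zero b λ k → zeroˡ _)) (+-identityʳ _)
  ∑-Δˡ (a ⊕ b)       (inj₂ i) f =
    trans (+-cong (∑-zero a λ k → zeroˡ _) (∑-Δˡ b i (f ∘ inj₂))) (+-identityˡ _)

  ∑-Δʳ : ∀ a j (f : El a → Carrier) → ∑ a (λ k → f k * Δ a k j) ≈ f j
  ∑-Δʳ a j f =
    trans (∑-cong a λ k → trans (*-comm _ _) (*-congʳ (Δ-sym a k j))) (∑-Δˡ a j f)

  -- Matrix algebra

  infix  4 _≋_
  infixl 6 _⊞_
  infixl 7 _⊗_
  infix  9 _ᵀ

  -- `El` is not injective, so with a bare function type the index sets could not be recovered from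
  -- a matrix; the wrapper makes them inferable.
  record M (a b : Ix) : Set c where
    constructor mk
    field at : El a → El b → Carrier
  open M public

  -- A record rather than a function, so that the matrices can be inferred.
  record _≋_ {a b} (A B : M a b) : Set ℓ where
    constructor ext
    field entry : ∀ i j → at A i j ≈ at B i j
  open _≋_ public

  ≋-setoid : Ix → Ix → Setoid c ℓ
  ≋-setoid a b = record
    { Carrier = M a b
    ; _≈_ = _≋_
    ; isEquivalence = record
      { refl  = ext λ _ _ → refl
      ; sym   = λ p → ext λ i j → sym (entry p i j)
      ; trans = λ p q → ext λ i j → trans (entry p i j) (entry q i j)
      }
    }

  module _ {a b : Ix} where
    open Setoid (≋-setoid a b) public
      using () renaming (refl to ≋-refl; sym to ≋-sym; trans to ≋-trans)
  module ≋-Reasoning {a b : Ix} = SetoidReasoning (≋-setoid a b)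

  _⊗_ : ∀ {a b d} → M a b → M b d → M a d
  _⊗_ {b = b} A B = mk λ i j → ∑ b λ k → at A i k * at B k j

  _⊞_ : ∀ {a b} → M a b → M a b → M a b
  A ⊞ B = mk λ i j → at A i j + at B i j

  ⊝_ : ∀ {a b} → M a b → M a b
  ⊝ A = mk λ i j → - at A i j

  𝟎 : ∀ {a b} → M a b
  𝟎 = mk λ _ _ → 0#

  𝟏 : ∀ {a} → M a a
  𝟏 {a} = mk (Δ a)

  _ᵀ : ∀ {a b} → M a b → M b a
  A ᵀ = mk λ i j → at A j i

  ⊗-cong : ∀ {a b d} {A A' : M a b} {B B' : M b d} → A ≋ A' → B ≋ B' → A ⊗ B ≋ A' ⊗ B'
  ⊗-cong {b = b} p q = ext λ i j → ∑-cong b λ k → *-cong (entry p i k) (entry q k j)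

  ⊗-congˡ : ∀ {a b d} {A : M a b} {B B' : M b d} → B ≋ B' → A ⊗ B ≋ A ⊗ B'
  ⊗-congˡ = ⊗-cong ≋-refl

  ⊗-congʳ : ∀ {a b d} {A A' : M a b} {B : M b d} → A ≋ A' → A ⊗ B ≋ A' ⊗ B
  ⊗-congʳ p = ⊗-cong p ≋-refl

  ⊗-assoc : ∀ {a b d e} (A : M a b) (B : M b d) (C : M d e) → (A ⊗ B) ⊗ C ≋ A ⊗ (B ⊗ C)
  ⊗-assoc {a} {b} {d} A B C = ext λ i j → begin
    ∑ d (λ l → ∑ b (λ k → at A i k * at B k l) * at C l j)
      ≈⟨ ∑-cong d (λ l → ∑-*ʳ b _ _) ⟩
    ∑ d (λ l → ∑ b (λ k → at A i k * at B k l * at C l j))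
      ≈⟨ ∑-swap d b _ ⟩
    ∑ b (λ k → ∑ d (λ l → at A i k * at B k l * at C l j))
      ≈⟨ ∑-cong b (λ k → trans (∑-cong d λ l → *-assoc _ _ _) (sym (∑-*ˡ d _ _))) ⟩
    ∑ b (λ k → at A i k * ∑ d (λ l → at B k l * at C l j)) ∎
    where open ≈-Reasoning

  ⊗-idˡ : ∀ {a b} (A : M a b) → 𝟏 ⊗ A ≋ A
  ⊗-idˡ {a} A = ext λ i j → ∑-Δˡ a i _

  ⊗-idʳ : ∀ {a b} (A : M a b) → A ⊗ 𝟏 ≋ A
  ⊗-idʳ {b = b} A = ext λ i j → ∑-Δʳ b j _

  ⊗-zeroˡ : ∀ {a b d} (A : M b d) → 𝟎 {a} ⊗ A ≋ 𝟎
  ⊗-zeroˡ {b = b} A = ext λ i j → ∑-zero b λ k → zeroˡ _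

  ⊗-zeroʳ : ∀ {a b d} (A : M a b) → A ⊗ 𝟎 {b} {d} ≋ 𝟎
  ⊗-zeroʳ {b = b} A = ext λ i j → ∑-zero b λ k → zeroʳ _

  ⊗-distribˡ : ∀ {a b d} (A : M a b) (B C : M b d) → A ⊗ (B ⊞ C) ≋ A ⊗ B ⊞ A ⊗ C
  ⊗-distribˡ {b = b} A B C = ext λ i j →
    trans (∑-cong b λ k → distribˡ _ _ _) (∑-+ b _ _)

  ⊗-distribʳ : ∀ {a b d} (C : M b d) (A B : M a b) → (A ⊞ B) ⊗ C ≋ A ⊗ C ⊞ B ⊗ C
  ⊗-distribʳ {b = b} C A B = ext λ i j →
    trans (∑-cong b λ k → distribʳ _ _ _) (∑-+ b _ _)

  ⊞-cong : ∀ {a b} {A A' B B' : M a b} → A ≋ A' → B ≋ B' → A ⊞ B ≋ A' ⊞ B'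
  ⊞-cong p q = ext λ i j → +-cong (entry p i j) (entry q i j)

  ⊞-congˡ : ∀ {a b} {A B B' : M a b} → B ≋ B' → A ⊞ B ≋ A ⊞ B'
  ⊞-congˡ = ⊞-cong ≋-refl

  ⊞-congʳ : ∀ {a b} {A A' B : M a b} → A ≋ A' → A ⊞ B ≋ A' ⊞ B
  ⊞-congʳ p = ⊞-cong p ≋-refl

  ⊞-assoc : ∀ {a b} (A B C : M a b) → (A ⊞ B) ⊞ C ≋ A ⊞ (B ⊞ C)
  ⊞-assoc A B C = ext λ i j → +-assoc _ _ _

  ⊞-comm : ∀ {a b} (A B : M a b) → A ⊞ B ≋ B ⊞ A
  ⊞-comm A B = ext λ i j → +-comm _ _

  ⊞-invʳ : ∀ {a b} (A : M a b) → A ⊞ (⊝ A) ≋ 𝟎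
  ⊞-invʳ A = ext λ i j → -‿inverseʳ _

  ⊞-invˡ : ∀ {a b} (A : M a b) → (⊝ A) ⊞ A ≋ 𝟎
  ⊞-invˡ A = ext λ i j → -‿inverseˡ _

  ⊞-≋ˡ : ∀ {a b} {A B Z : M a b} → A ≋ B → Z ≋ 𝟎 → A ⊞ Z ≋ B
  ⊞-≋ˡ p q = ext λ i j → trans (+-cong (entry p i j) (entry q i j)) (+-identityʳ _)

  ⊞-≋ʳ : ∀ {a b} {A B Z : M a b} → Z ≋ 𝟎 → A ≋ B → Z ⊞ A ≋ B
  ⊞-≋ʳ p q = ext λ i j → trans (+-cong (entry p i j) (entry q i j)) (+-identityˡ _)

  ᵀ-⊗ : ∀ {a b d} (A : M a b) (B : M b d) → (A ⊗ B) ᵀ ≋ B ᵀ ⊗ A ᵀ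
  ᵀ-⊗ {b = b} A B = ext λ i j → ∑-cong b λ k → *-comm _ _

  ᵀ-cong : ∀ {a b} {A B : M a b} → A ≋ B → A ᵀ ≋ B ᵀ
  ᵀ-cong p = ext λ i j → entry p j i

  ᵀ-𝟏 : ∀ {a} → 𝟏 {a} ᵀ ≋ 𝟏
  ᵀ-𝟏 {a} = ext λ i j → Δ-sym a j i

  blocks : ∀ {a a' b b'} → M a b → M a b' → M a' b → M a' b' →
           El (a ⊕ a') → El (b ⊕ b') → Carrier
  blocks A B C D (inj₁ i) (inj₁ j) = at A i j
  blocks A B C D (inj₁ i) (inj₂ j) = at B i j
  blocks A B C D (inj₂ i) (inj₁ j) = at C i j
  blocks A B C D (inj₂ i) (inj₂ j) = at D i j

  blk : ∀ {a a' b b'} → M a b → M a b' → M a' b → M a' b' → M (a ⊕ a') (b ⊕ b')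
  blk A B C D = mk (blocks A B C D)

  module _ {a a' b b'} (E : M (a ⊕ a') (b ⊕ b')) where
    ⌜_⌝ : M a b
    ⌜_⌝ = mk λ i j → at E (inj₁ i) (inj₁ j)
    ⌝_⌜ : M a b'
    ⌝_⌜ = mk λ i j → at E (inj₁ i) (inj₂ j)
    ⌞_⌟ : M a' b
    ⌞_⌟ = mk λ i j → at E (inj₂ i) (inj₁ j)
    ⌟_⌞ : M a' b'
    ⌟_⌞ = mk λ i j → at E (inj₂ i) (inj₂ j)

  blk-ext : ∀ {a a' b b'} {E E' : M (a ⊕ a') (b ⊕ b')} →
            ⌜ E ⌝ ≋ ⌜ E' ⌝ → ⌝ E ⌜ ≋ ⌝ E' ⌜ → ⌞ E ⌟ ≋ ⌞ E' ⌟ → ⌟ E ⌞ ≋ ⌟ E' ⌞ → E ≋ E'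
  blk-ext p q r s = ext λ where
    (inj₁ i) (inj₁ j) → entry p i j
    (inj₁ i) (inj₂ j) → entry q i j
    (inj₂ i) (inj₁ j) → entry r i j
    (inj₂ i) (inj₂ j) → entry s i j

  infix 8 _⊠_
  _⊠_ : ∀ {a a' b b'} → M a b → M a' b' → M (a ⊕ a') (b ⊕ b')
  A ⊠ B = blk A 𝟎 𝟎 B

  [_] : Carrier → M 𝟙 𝟙
  [ x ] = mk λ _ _ → x

  -- Similarity

  record Iso (a b : Ix) : Set (c ⊔ ℓ) where
    constructor iso
    field
      to   : M a b
      from : M b a
      to-from : to ⊗ from ≋ 𝟏
      from-to : from ⊗ to ≋ 𝟏
  open Iso public

  -- The index sets may differ, so relabelling counts as similarity. The intertwining form keeps the
  -- inverse out of the equation, which can then be checked block by block.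
  record Sim {a b} (A : M a a) (B : M b b) : Set (c ⊔ ℓ) where
    constructor sim
    field
      basis : Iso a b
      intertwine : A ⊗ to basis ≋ to basis ⊗ B
  open Sim public

  Iso-refl : ∀ {a} → Iso a a
  Iso-refl = iso 𝟏 𝟏 (⊗-idˡ 𝟏) (⊗-idˡ 𝟏)

  Iso-sym : ∀ {a b} → Iso a b → Iso b a
  Iso-sym (iso S T p q) = iso T S q p

  cancel-inner : ∀ {a b d e} (S : M b d) (T : M d b) (A : M a b) (B : M b e) →
                 S ⊗ T ≋ 𝟏 → (A ⊗ S) ⊗ (T ⊗ B) ≋ A ⊗ B
  cancel-inner S T A B p = begin
    (A ⊗ S) ⊗ (T ⊗ B)  ≈⟨ ⊗-assoc A S (T ⊗ B) ⟩
    A ⊗ (S ⊗ (T ⊗ B))  ≈⟨ ⊗-congˡ (⊗-assoc S T B) ⟨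
    A ⊗ ((S ⊗ T) ⊗ B)  ≈⟨ ⊗-congˡ (⊗-congʳ p) ⟩
    A ⊗ (𝟏 ⊗ B)        ≈⟨ ⊗-congˡ (⊗-idˡ B) ⟩
    A ⊗ B              ∎
    where open ≋-Reasoning

  cancelˡ : ∀ {a b d} (S : M a b) (T : M b a) (A : M a d) → S ⊗ T ≋ 𝟏 → S ⊗ (T ⊗ A) ≋ A
  cancelˡ S T A p = begin
    S ⊗ (T ⊗ A)  ≈⟨ ⊗-assoc S T A ⟨
    (S ⊗ T) ⊗ A  ≈⟨ ⊗-congʳ p ⟩
    𝟏 ⊗ A        ≈⟨ ⊗-idˡ A ⟩
    A            ∎
    where open ≋-Reasoning

  cancelʳ : ∀ {a b d} (S : M a b) (T : M b a) (A : M d a) → S ⊗ T ≋ 𝟏 → (A ⊗ S) ⊗ T ≋ A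
  cancelʳ S T A p = begin
    (A ⊗ S) ⊗ T  ≈⟨ ⊗-assoc A S T ⟩
    A ⊗ (S ⊗ T)  ≈⟨ ⊗-congˡ p ⟩
    A ⊗ 𝟏        ≈⟨ ⊗-idʳ A ⟩
    A            ∎
    where open ≋-Reasoning

  Iso-trans : ∀ {a b d} → Iso a b → Iso b d → Iso a d
  Iso-trans (iso S T p q) (iso S' T' p' q') = iso (S ⊗ S') (T' ⊗ T)
    (≋-trans (cancel-inner S' T' S T p') p) (≋-trans (cancel-inner T S T' S' q) q')

  Iso-⊠ : ∀ {a a' b b'} → Iso a b → Iso a' b' → Iso (a ⊕ a') (b ⊕ b')
  Iso-⊠ (iso S T p q) (iso S' T' p' q') = iso (S ⊠ S') (T ⊠ T') (go S T S' T' p p') (go T S T' S' q q')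
    where
    go : ∀ {a a' b b'} (S : M a b) (T : M b a) (S' : M a' b') (T' : M b' a') →
         S ⊗ T ≋ 𝟏 → S' ⊗ T' ≋ 𝟏 → (S ⊠ S') ⊗ (T ⊠ T') ≋ 𝟏
    go {a} {a'} {b} {b'} S T S' T' p p' = blk-ext
      (⊞-≋ˡ p (⊗-zeroˡ {b = b'} 𝟎))
      (⊞-≋ˡ (⊗-zeroʳ S) (⊗-zeroˡ T'))
      (⊞-≋ˡ (⊗-zeroˡ T) (⊗-zeroʳ S'))
      (⊞-≋ʳ (⊗-zeroˡ {b = b} 𝟎) p')

  ≋⇒Sim : ∀ {a} {A B : M a a} → A ≋ B → Sim A B
  ≋⇒Sim {A = A} {B} p = sim Iso-refl (≋-trans (⊗-idʳ A) (≋-trans p (≋-sym (⊗-idˡ B))))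

  Sim-trans : ∀ {a b d} {A : M a a} {B : M b b} {C : M d d} → Sim A B → Sim B C → Sim A C
  Sim-trans {A = A} {B} {C} (sim s p) (sim t q) = sim (Iso-trans s t) (begin
    A ⊗ (to s ⊗ to t)  ≈⟨ ⊗-assoc A (to s) (to t) ⟨
    (A ⊗ to s) ⊗ to t  ≈⟨ ⊗-congʳ p ⟩
    (to s ⊗ B) ⊗ to t  ≈⟨ ⊗-assoc (to s) B (to t) ⟩
    to s ⊗ (B ⊗ to t)  ≈⟨ ⊗-congˡ q ⟩
    to s ⊗ (to t ⊗ C)  ≈⟨ ⊗-assoc (to s) (to t) C ⟨
    (to s ⊗ to t) ⊗ C  ∎)
    where open ≋-Reasoning

  Sim-sym : ∀ {a b} {A : M a a} {B : M b b} → Sim A B → Sim B A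
  Sim-sym {A = A} {B} (sim s@(iso S T p q) r) = sim (Iso-sym s) (begin
    B ⊗ T              ≈⟨ cancelˡ T S (B ⊗ T) q ⟨
    T ⊗ (S ⊗ (B ⊗ T))  ≈⟨ ⊗-congˡ (⊗-assoc S B T) ⟨
    T ⊗ ((S ⊗ B) ⊗ T)  ≈⟨ ⊗-congˡ (⊗-congʳ r) ⟨
    T ⊗ ((A ⊗ S) ⊗ T)  ≈⟨ ⊗-congˡ (cancelʳ S T A p) ⟩
    T ⊗ A              ∎)
    where open ≋-Reasoning

  Sim-ᵀ : ∀ {a b} {A : M a a} {B : M b b} → Sim A B → Sim (B ᵀ) (A ᵀ)
  Sim-ᵀ {A = A} {B} (sim (iso S T p q) r) = sim
    (iso (S ᵀ) (T ᵀ) (≋-trans (≋-sym (ᵀ-⊗ T S)) (≋-trans (ᵀ-cong q) ᵀ-𝟏))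
                     (≋-trans (≋-sym (ᵀ-⊗ S T)) (≋-trans (ᵀ-cong p) ᵀ-𝟏)))
    (≋-trans (≋-sym (ᵀ-⊗ S B)) (≋-trans (ᵀ-cong (≋-sym r)) (ᵀ-⊗ A S)))

  Sim-⊠ : ∀ {a a' b b'} {A : M a a} {A' : M a' a'} {B : M b b} {B' : M b' b'} →
          Sim A B → Sim A' B' → Sim (A ⊠ A') (B ⊠ B')
  Sim-⊠ {a} {a'} {b} {b'} {A} {A'} {B} {B'} (sim s p) (sim s' p') = sim (Iso-⊠ s s') (blk-ext
    (⊞-cong p (𝟎⊗𝟎 a' b'))
    (⊞-cong (≋-trans (⊗-zeroʳ A) (≋-sym (⊗-zeroʳ (to s))))
            (≋-trans (⊗-zeroˡ (to s')) (≋-sym (⊗-zeroˡ B'))))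
    (⊞-cong (≋-trans (⊗-zeroˡ (to s)) (≋-sym (⊗-zeroˡ B)))
            (≋-trans (⊗-zeroʳ A') (≋-sym (⊗-zeroʳ (to s')))))
    (⊞-cong (𝟎⊗𝟎 a b) p'))
    where
    𝟎⊗𝟎 : ∀ b b' {a d} → 𝟎 {a} {b} ⊗ 𝟎 {b} {d} ≋ 𝟎 {a} {b'} ⊗ 𝟎 {b'} {d}
    𝟎⊗𝟎 b b' = ≋-trans (⊗-zeroˡ {b = b} 𝟎) (≋-sym (⊗-zeroˡ {b = b'} 𝟎))

  conjugate : ∀ {a b} → Iso a b → M a a → M b b
  conjugate s A = from s ⊗ (A ⊗ to s)

  Sim-conjugate : ∀ {a b} (s : Iso a b) (A : M a a) → Sim A (conjugate s A)
  Sim-conjugate s A = sim s (≋-sym (cancelˡ (to s) (from s) (A ⊗ to s) (to-from s)))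

  module _ {a b} (e : El b → El a) (e⁻¹ : El a → El b)
           (right : ∀ i → e (e⁻¹ i) ≡ i) (left : ∀ j → e⁻¹ (e j) ≡ j) where

    relabelling : Iso a b
    relabelling = iso (mk λ i j → Δ b (e⁻¹ i) j) (mk λ j i → Δ a (e j) i)
      (ext λ i i' → trans (∑-Δˡ b (e⁻¹ i) _) (reflexive (≡.cong (λ k → Δ a k i') (right i))))
      (ext λ j j' → trans (∑-Δˡ a (e j) _) (reflexive (≡.cong (λ k → Δ b k j') (left j))))

    relabelling-⊗ : ∀ {d} (A : M b d) i j → at (to relabelling ⊗ A) i j ≈ at A (e⁻¹ i) j
    relabelling-⊗ A i j = ∑-Δˡ b (e⁻¹ i) _

    Sim-relabel : (A : M a a) → Sim A (mk λ i j → at A (e i) (e j))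
    Sim-relabel A = sim relabelling (ext λ i j → begin
      ∑ a (λ k → at A i k * Δ b (e⁻¹ k) j)
        ≈⟨ ∑-cong a (λ k → *-congˡ (Δ-iff b a (λ p → ≡.trans (≡.sym (right k)) (≡.cong e p))
                                              (λ p → ≡.trans (≡.cong e⁻¹ p) (left j)))) ⟩
      ∑ a (λ k → at A i k * Δ a k (e j))
        ≈⟨ ∑-Δʳ a (e j) _ ⟩
      at A i (e j)
        ≈⟨ reflexive (≡.cong (λ k → at A k (e j)) (right i)) ⟨
      at A (e (e⁻¹ i)) (e j)
        ≈⟨ ∑-Δˡ b (e⁻¹ i) _ ⟨
      ∑ b (λ k → Δ b (e⁻¹ i) k * at A (e k) (e j)) ∎)
      where open ≈-Reasoning

  shear : ∀ {a b} → M a b → Iso (a ⊕ b) (a ⊕ b)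
  shear Y = iso (blk 𝟏 Y 𝟎 𝟏) (blk 𝟏 (⊝ Y) 𝟎 𝟏) (go Y (⊝ Y) (⊞-invʳ Y)) (go (⊝ Y) Y (⊞-invˡ Y))
    where
    go : ∀ {a b} (Y Z : M a b) → Y ⊞ Z ≋ 𝟎 → blk 𝟏 Y 𝟎 𝟏 ⊗ blk 𝟏 Z 𝟎 𝟏 ≋ 𝟏
    go Y Z p = blk-ext
      (⊞-≋ˡ (⊗-idˡ 𝟏) (⊗-zeroʳ Y))
      (≋-trans (⊞-cong (⊗-idˡ Z) (⊗-idʳ Y)) (≋-trans (⊞-comm Z Y) p))
      (⊞-≋ˡ (⊗-zeroˡ 𝟏) (⊗-zeroʳ 𝟏))
      (⊞-≋ʳ (⊗-zeroˡ Z) (⊗-idˡ 𝟏))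

  -- Conjugation by ( 1 Y ; 0 1 ) leaves the diagonal blocks alone, so only the upper right blocks
  -- have to be compared. Solving this Sylvester equation with `X'` = 0 decouples `A` from `B`.
  Sim-shear : ∀ {a b} {A : M a a} {X X' : M a b} {B : M b b} (Y : M a b) →
              A ⊗ Y ⊞ X ≋ X' ⊞ Y ⊗ B → Sim (blk A X 𝟎 B) (blk A X' 𝟎 B)
  Sim-shear {A = A} {X} {X'} {B} Y p = sim (shear Y) (blk-ext
    (⊞-cong (≋-trans (⊗-idʳ A) (≋-sym (⊗-idˡ A)))
            (≋-trans (⊗-zeroʳ X) (≋-sym (⊗-zeroʳ Y))))
    (≋-trans (⊞-congˡ (⊗-idʳ X)) (≋-trans p (⊞-congʳ (≋-sym (⊗-idˡ X')))))
    (≋-trans (⊞-≋ˡ (⊗-zeroˡ 𝟏) (⊗-zeroʳ B)) (≋-sym (⊞-≋ˡ (⊗-zeroˡ A) (⊗-zeroʳ 𝟏))))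
    (≋-trans (⊞-≋ʳ (⊗-zeroˡ Y) (⊗-idʳ B)) (≋-sym (⊞-≋ʳ (⊗-zeroˡ X') (⊗-idˡ B)))))

  Sim-lower : ∀ {a b b'} (E : M (a ⊕ b) (a ⊕ b)) (s : Iso b b') →
    Sim E (blk ⌜ E ⌝ (⌝ E ⌜ ⊗ to s) (from s ⊗ ⌞ E ⌟) (from s ⊗ (⌟ E ⌞ ⊗ to s)))
  Sim-lower E s@(iso S T p _) = sim (Iso-⊠ Iso-refl s) (blk-ext
    (≋-trans (⊞-≋ˡ (⊗-idʳ A) (⊗-zeroʳ B))
             (≋-sym (⊞-≋ˡ (⊗-idˡ A) (⊗-zeroˡ (T ⊗ C)))))
    (≋-trans (⊞-≋ʳ (⊗-zeroʳ A) ≋-refl)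
             (≋-sym (⊞-≋ˡ (⊗-idˡ (B ⊗ S)) (⊗-zeroˡ (T ⊗ (D ⊗ S))))))
    (≋-trans (⊞-≋ˡ (⊗-idʳ C) (⊗-zeroʳ D))
             (≋-sym (⊞-≋ʳ (⊗-zeroˡ A) (cancelˡ S T C p))))
    (≋-trans (⊞-≋ʳ (⊗-zeroʳ C) ≋-refl)
             (≋-sym (⊞-≋ʳ (⊗-zeroˡ (B ⊗ S)) (cancelˡ S T (D ⊗ S) p)))))
    where
    A = ⌜ E ⌝
    B = ⌝ E ⌜
    C = ⌞ E ⌟
    D = ⌟ E ⌞

  Sim-swap : ∀ {a b} (A : M a a) (B : M a b) (C : M b a) (D : M b b) →
             Sim (blk A B C D) (blk D C B A)
  Sim-swap A B C D = Sim-trans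
    (Sim-relabel swap swap swap-involutive swap-involutive (blk A B C D))
    (≋⇒Sim (blk-ext ≋-refl ≋-refl ≋-refl ≋-refl))

  -- Replacing the i-th standard basis vector by w gives a basis since wᵢ ≠ 0.
  module _ {r} (w : M (fin (suc r)) 𝟙) (i : Fin (suc r)) (wᵢ≉0 : ¬ (at w i tt ≈ 0#)) where

    private
      x = at w i tt
      y = proj₁ (inverse x wᵢ≉0)
      xy≈1 = proj₂ (inverse x wᵢ≉0)

      u : M (fin r) 𝟙
      u = mk λ j _ → at w (punchIn i j) tt

      e : El (𝟙 ⊕ fin r) → Fin (suc r)
      e (inj₁ _) = i
      e (inj₂ j) = punchIn i j

      e⁻¹ : Fin (suc r) → El (𝟙 ⊕ fin r)
      e⁻¹ k with i Fin.≟ k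
      ... | yes _   = inj₁ tt
      ... | no  i≢k = inj₂ (punchOut i≢k)

      e-e⁻¹ : ∀ k → e (e⁻¹ k) ≡ k
      e-e⁻¹ k with i Fin.≟ k
      ... | yes i≡k = i≡k
      ... | no  i≢k = Fin.punchIn-punchOut i≢k

      e⁻¹-e : ∀ j → e⁻¹ (e j) ≡ j
      e⁻¹-e (inj₁ _) with i Fin.≟ i
      ... | yes _   = ≡.refl
      ... | no  i≢i = contradiction ≡.refl i≢i
      e⁻¹-e (inj₂ j) with i Fin.≟ punchIn i j
      ... | yes i≡k = contradiction (≡.sym i≡k) (Fin.punchInᵢ≢i i j)
      ... | no  i≢k = ≡.cong inj₂
        (≡.trans (Fin.punchOut-cong i ≡.refl) (Fin.punchOut-punchIn i))

      column : Iso (𝟙 ⊕ fin r) (𝟙 ⊕ fin r)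
      column = iso (blk [ x ] 𝟎 u 𝟏) (blk [ y ] 𝟎 (⊝ (u ⊗ [ y ])) 𝟏)
        (blk-ext
          (⊞-≋ˡ (ext λ _ _ → xy≈1) (⊗-zeroˡ (⊝ (u ⊗ [ y ]))))
          (⊞-≋ˡ (⊗-zeroʳ [ x ]) (⊗-zeroˡ 𝟏))
          (≋-trans (⊞-congˡ (⊗-idˡ _)) (⊞-invʳ (u ⊗ [ y ])))
          (⊞-≋ʳ (⊗-zeroʳ u) (⊗-idˡ 𝟏)))
        (blk-ext
          (⊞-≋ˡ (ext λ _ _ → trans (*-comm y x) xy≈1) (⊗-zeroˡ u))
          (⊞-≋ˡ (⊗-zeroʳ [ y ]) (⊗-zeroˡ 𝟏))
          (≋-trans (⊞-cong (ext λ j _ → undo (at u j tt)) (⊗-idˡ u)) (⊞-invˡ u))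
          (⊞-≋ʳ (⊗-zeroʳ (⊝ (u ⊗ [ y ]))) (⊗-idˡ 𝟏)))
        where
        undo : ∀ z → - (z * y) * x ≈ - z
        undo z = begin
          - (z * y) * x    ≈⟨ -‿distribˡ-* (z * y) x ⟨
          - (z * y * x)    ≈⟨ -‿cong (*-assoc z y x) ⟩
          - (z * (y * x))  ≈⟨ -‿cong (*-congˡ (trans (*-comm y x) xy≈1)) ⟩
          - (z * 1#)       ≈⟨ -‿cong (*-identityʳ z) ⟩
          - z              ∎
          where open ≈-Reasoning

    pivot : Iso (fin (suc r)) (𝟙 ⊕ fin r)
    pivot = Iso-trans (relabelling e e⁻¹ e-e⁻¹ e⁻¹-e) column

    -- The first column of `to pivot` is `w`, so the inverse sends `w` to the first standard basis
    -- vector.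
    pivot-first : from pivot ⊗ w ≋ mk λ k _ → Δ (𝟙 ⊕ fin r) k (inj₁ tt)
    pivot-first = ≋-trans (⊗-congˡ {A = from pivot} w≋) (cancelˡ (from pivot) (to pivot) _ (from-to pivot))
      where
      first : ∀ k → at (to column) k (inj₁ tt) ≈ at w (e k) tt
      first (inj₁ _) = refl
      first (inj₂ _) = refl
      w≋ : w ≋ to pivot ⊗ mk λ k _ → Δ (𝟙 ⊕ fin r) k (inj₁ tt)
      w≋ = ext λ k _ → sym (begin
        at (to pivot ⊗ mk λ k _ → Δ (𝟙 ⊕ fin r) k (inj₁ tt)) k tt
          ≈⟨ ∑-Δʳ (𝟙 ⊕ fin r) (inj₁ tt) (at (to pivot) k) ⟩
        at (to pivot) k (inj₁ tt)
          ≈⟨ relabelling-⊗ e e⁻¹ e-e⁻¹ e⁻¹-e (to column) k (inj₁ tt) ⟩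
        at (to column) (e⁻¹ k) (inj₁ tt)
          ≈⟨ first (e⁻¹ k) ⟩
        at w (e (e⁻¹ k)) tt
          ≡⟨ ≡.cong (λ k → at w k tt) (e-e⁻¹ k) ⟩
        at w k tt ∎)
        where open ≈-Reasoning

  -- Krylov chains.

  -- The basis is listed backwards: the vector of index j + 1 is mapped to
  -- the vector of index j plus vectors of larger index.

  Hess : ∀ {m} → M (fin m) (fin m) → Set ℓ
  Hess H = (∀ i j → toℕ j ≡ suc (toℕ i) → at H i j ≈ 1#)
         × (∀ i j → suc (toℕ i) < toℕ j → at H i j ≈ 0#)

  Hess-tail : ∀ {m} {H : M (fin (suc m)) (fin (suc m))} → Hess H →
              Hess (mk λ i j → at H (suc i) (suc j))
  Hess-tail (one , zer) = (λ i j p → one (suc i) (suc j) (≡.cong suc p))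
                        , (λ i j p → zer (suc i) (suc j) (s≤s p))

  -- Index 0 is the last vector of the chain. Only its image may leave the span of the chain, so the
  -- lower left block is unconstrained in column 0 alone.
  Chain : ∀ {m r} → M (fin (suc m) ⊕ fin r) (fin (suc m) ⊕ fin r) → Set ℓ
  Chain E = Hess ⌜ E ⌝ × (∀ i j → at E (inj₂ i) (inj₁ (suc j)) ≈ 0#)

  -- The image of the last chain vector has a nonzero component `w` outside the chain. In a basis of
  -- the complement starting with `w`, this vector can be moved to the front of the chain, as its
  -- new last member.
  extend : ∀ {m r} (E : M (fin (suc m) ⊕ fin (suc r)) (fin (suc m) ⊕ fin (suc r))) →
           Chain E → ∀ i → ¬ (at E (inj₂ i) (inj₁ zero) ≈ 0#) →
           Σ (M (fin (suc (suc m)) ⊕ fin r) (fin (suc (suc m)) ⊕ fin r)) λ E' →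
             Chain E' × Sim E E'
  extend {m} {r} E ((one , zer) , low) i w≉0 =
    E' , ((one' , zer') , low') ,
    Sim-trans (Sim-lower E s) (Sim-relabel e e⁻¹ e-e⁻¹ e⁻¹-e G)
    where
    w : M (fin (suc r)) 𝟙
    w = mk λ k _ → at E (inj₂ k) (inj₁ zero)

    s = pivot w i w≉0
    G = blk ⌜ E ⌝ (⌝ E ⌜ ⊗ to s) (from s ⊗ ⌞ E ⌟) (from s ⊗ (⌟ E ⌞ ⊗ to s))

    e : El (fin (suc (suc m)) ⊕ fin r) → El (fin (suc m) ⊕ (𝟙 ⊕ fin r))
    e (inj₁ zero)    = inj₂ (inj₁ tt)
    e (inj₁ (suc j)) = inj₁ j
    e (inj₂ j)       = inj₂ (inj₂ j)

    e⁻¹ : El (fin (suc m) ⊕ (𝟙 ⊕ fin r)) → El (fin (suc (suc m)) ⊕ fin r)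
    e⁻¹ (inj₂ (inj₁ _)) = inj₁ zero
    e⁻¹ (inj₁ j)        = inj₁ (suc j)
    e⁻¹ (inj₂ (inj₂ j)) = inj₂ j

    e-e⁻¹ : ∀ k → e (e⁻¹ k) ≡ k
    e-e⁻¹ (inj₂ (inj₁ _)) = ≡.refl
    e-e⁻¹ (inj₁ j)        = ≡.refl
    e-e⁻¹ (inj₂ (inj₂ j)) = ≡.refl

    e⁻¹-e : ∀ k → e⁻¹ (e k) ≡ k
    e⁻¹-e (inj₁ zero)    = ≡.refl
    e⁻¹-e (inj₁ (suc j)) = ≡.refl
    e⁻¹-e (inj₂ j)       = ≡.refl

    E' : M (fin (suc (suc m)) ⊕ fin r) (fin (suc (suc m)) ⊕ fin r)
    E' = mk λ i j → at G (e i) (e j)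

    below : ∀ k j → at (from s ⊗ ⌞ E ⌟) k (suc j) ≈ 0#
    below k j = ∑-zero (fin (suc r)) λ l → trans (*-congˡ {at (from s) k l} (low l j)) (zeroʳ _)

    one' : ∀ i j → toℕ j ≡ suc (toℕ i) → at E' (inj₁ i) (inj₁ j) ≈ 1#
    one' zero    (suc zero) p = entry (pivot-first w i w≉0) (inj₁ tt) tt
    one' (suc i) (suc j)    p = one i j (ℕ.suc-injective p)

    zer' : ∀ i j → suc (toℕ i) < toℕ j → at E' (inj₁ i) (inj₁ j) ≈ 0#
    zer' zero    (suc zero)    (s≤s ())
    zer' zero    (suc (suc j)) p       = below (inj₁ tt) j
    zer' (suc i) (suc j)       (s≤s p) = zer i j p

    low' : ∀ i j → at E' (inj₂ i) (inj₁ (suc j)) ≈ 0#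
    low' k zero    = entry (pivot-first w i w≉0) (inj₂ k) tt
    low' k (suc j) = below (inj₂ k) j

  -- Row i of the Sylvester equation HY + X = YC contains row i + 1 of Y with coefficient 1 and no
  -- later row, so it determines that row from the earlier ones. Row 0 of Y stays free, and the last
  -- row of the equation stays unsolved. The free row is a parameter because the recursion on the
  -- trailing block has to prescribe it.
  clear-rows : ∀ {m r} (H : M (fin (suc m)) (fin (suc m))) → Hess H →
    (X : M (fin (suc m)) (fin r)) (C : M (fin r) (fin r)) (y : Fin r → Carrier) →
    Σ (M (fin (suc m)) (fin r)) λ Y → (∀ j → at Y zero j ≡ y j) ×
      (∀ i j → at (H ⊗ Y) (inject₁ i) j + at X (inject₁ i) j ≈ at (Y ⊗ C) (inject₁ i) j)
  clear-rows {zero}  H h X C y = (mk λ _ j → y j) , (λ _ → ≡.refl) , λ ()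
  clear-rows {suc m} {r} H h@(one , zer) X C y = Y , (λ _ → ≡.refl) , rows
    where
    yC = λ j → ∑ (fin r) (λ k → y k * at C k j)
    -- The value that row 0 of the equation forces on row 1 of `Y`.
    y' : Fin r → Carrier
    y' j = - at X zero j + (- (at H zero zero * y j) + yC j)

    -- Row 0 of `Y` is known by now, so its contribution through column 0 of `H` joins the constant
    -- term.
    X' : M (fin (suc m)) (fin r)
    X' = mk λ i j → at H (suc i) zero * y j + at X (suc i) j

    ih = clear-rows (mk λ i j → at H (suc i) (suc j)) (Hess-tail {H = H} h) X' C y'
    Y' = proj₁ ih
    Y'-first = proj₁ (proj₂ ih)
    Y'-rows = proj₂ (proj₂ ih)

    Y : M (fin (suc (suc m))) (fin r)
    Y = mk λ { zero j → y j ; (suc i) j → at Y' i j }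

    first : ∀ j → at H zero zero * y j
                + (at H zero (suc zero) * at Y' zero j
                   + ∑ (fin m) (λ k → at H zero (suc (suc k)) * at Y' (suc k) j))
                + at X zero j ≈ yC j
    first j = begin
      p + (at H zero (suc zero) * at Y' zero j + ∑ (fin m) _) + x
        ≈⟨ +-congʳ (+-congˡ (+-cong
             (trans (*-cong (one zero (suc zero) ≡.refl) (reflexive (Y'-first j))) (*-identityˡ _))
             (∑-zero (fin m) λ k → trans (*-congʳ (zer zero (suc (suc k)) (s≤s (s≤s z≤n)))) (zeroˡ _)))) ⟩
      p + (y' j + 0#) + x
        ≈⟨ +-congʳ (+-congˡ (+-identityʳ _)) ⟩
      p + (- x + (- p + yC j)) + x
        ≈⟨ +-congʳ (x∙yz≈y∙xz p (- x) (- p + yC j)) ⟩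
      - x + (p + (- p + yC j)) + x
        ≈⟨ +-congʳ (+-congˡ (trans (sym (+-assoc _ _ _))
             (trans (+-congʳ (-‿inverseʳ p)) (+-identityˡ _)))) ⟩
      - x + yC j + x
        ≈⟨ trans (+-comm _ _) (sym (+-assoc _ _ _)) ⟩
      x + - x + yC j
        ≈⟨ trans (+-congʳ (-‿inverseʳ x)) (+-identityˡ _) ⟩
      yC j ∎
      where
      open ≈-Reasoning
      p = at H zero zero * y j
      x = at X zero j

    rows : ∀ i j → at (H ⊗ Y) (inject₁ i) j + at X (inject₁ i) j ≈ at (Y ⊗ C) (inject₁ i) j
    rows zero    j = first j
    rows (suc i) j =
      trans (+-congʳ (+-comm _ _)) (trans (+-assoc _ _ _) (Y'-rows i j))

  -- Companion matrices

  -- m + 1 indices as nested unions, so that taking off the first row and column of a matrix is a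
  -- case of the block notation.
  ch : ℕ → Ix
  ch zero    = 𝟙
  ch (suc m) = 𝟙 ⊕ ch m

  -- The first row of the identity matrix.
  ε : ∀ m → M 𝟙 (ch m)
  ε zero    = [ 1# ]
  ε (suc m) = mk λ { _ (inj₁ _) → 1# ; _ (inj₂ _) → 0# }

  -- The nilpotent Jordan block, with ones just above the diagonal.
  N : ∀ m → M (ch m) (ch m)
  N zero    = [ 0# ]
  N (suc m) = blk [ 0# ] (ε m) 𝟎 (N m)

  Companion : ∀ m → M (ch m) 𝟙 → M (ch m) (ch m)
  Companion m v = N m ⊞ v ⊗ ε m

  stack : ∀ {a b d} → M a d → M b d → M (a ⊕ b) d
  stack A B = mk λ { (inj₁ i) j → at A i j ; (inj₂ i) j → at B i j }

  Companion-suc : ∀ m (d : M 𝟙 𝟙) (u : M (ch m) 𝟙) →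
                  Companion (suc m) (stack d u) ≋ blk d (ε m) u (N m)
  Companion-suc m d u = blk-ext
    (ext λ i j → trans (+-identityˡ _) (*-identityʳ _))
    (ext λ i j → trans (+-congˡ (zeroʳ _)) (+-identityʳ _))
    (ext λ i j → trans (+-identityˡ _) (*-identityʳ _))
    (ext λ i j → trans (+-congˡ (zeroʳ _)) (+-identityʳ _))

  -- `Hess` unfolded along the recursion of `ch`: to the right of its diagonal entry each row has a
  -- 1 and then zeros.
  data IsHess : ∀ m → M (ch m) (ch m) → Set (c ⊔ ℓ) where
    single : ∀ {H} → IsHess zero H
    step   : ∀ {m H} → ⌝ H ⌜ ≋ ε m → IsHess m ⌟ H ⌞ → IsHess (suc m) H

  -- Once the trailing block is N + w ε, conjugating by ( 1 0 ; w 1 )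
  -- subtracts w ε from it and only changes the first column otherwise.
  to-Companion : ∀ m (H : M (ch m) (ch m)) → IsHess m H →
    Σ (M (ch m) 𝟙) λ v → Σ (Iso (ch m) (ch m)) λ s →
      (H ⊗ to s ≋ to s ⊗ Companion m v) × (ε m ⊗ to s ≋ ε m)
  to-Companion zero    H _ = H , Iso-refl ,
    intertwine (≋⇒Sim {A = H} (ext λ i j → sym (trans (+-identityˡ _) (*-identityʳ _)))) ,
    ⊗-idʳ (ε zero)
  to-Companion (suc m) H (step top rest) = stack d' v , s , eq , first
    where
    open ≋-Reasoning
    ih = to-Companion m ⌟ H ⌞ rest
    w  = proj₁ ih
    s' = proj₁ (proj₂ ih)
    S  = to s'
    T  = from s'
    eq' = proj₁ (proj₂ (proj₂ ih))
    -- The inner change of basis fixes the row `ε m`, hence also the upper right block of `H`.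
    first' = proj₂ (proj₂ (proj₂ ih))
    d = ⌜ H ⌝
    u = ⌞ H ⌟
    K = Companion m w
    -- `d'` and `v` are forced by comparing first columns in `eq`: the upper entries give `d'`, and
    -- the lower ones read S z = S (w d' + v).
    d' = d ⊞ ε m ⊗ w
    z = T ⊗ u ⊞ K ⊗ w
    v = ⊝ (w ⊗ d') ⊞ z
    Sw = S ⊗ w

    s : Iso (ch (suc m)) (ch (suc m))
    s = iso (blk 𝟏 𝟎 Sw S) (blk 𝟏 𝟎 (⊝ w) T)
      (blk-ext (⊞-≋ˡ (⊗-idˡ 𝟏) (⊗-zeroˡ (⊝ w)))
               (⊞-≋ˡ (⊗-idˡ 𝟎) (⊗-zeroˡ T))
               (begin
                 Sw ⊗ 𝟏 ⊞ S ⊗ (⊝ w)  ≈⟨ ⊞-congʳ (⊗-idʳ Sw) ⟩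
                 S ⊗ w ⊞ S ⊗ (⊝ w)   ≈⟨ ⊗-distribˡ S w (⊝ w) ⟨
                 S ⊗ (w ⊞ ⊝ w)       ≈⟨ ⊗-congˡ (⊞-invʳ w) ⟩
                 S ⊗ 𝟎               ≈⟨ ⊗-zeroʳ S ⟩
                 𝟎                   ∎)
               (⊞-≋ʳ (⊗-zeroʳ Sw) (to-from s')))
      (blk-ext (⊞-≋ˡ (⊗-idˡ 𝟏) (⊗-zeroˡ Sw))
               (⊞-≋ˡ (⊗-idˡ 𝟎) (⊗-zeroˡ S))
               (≋-trans (⊞-cong (⊗-idʳ (⊝ w)) (cancelˡ T S w (from-to s'))) (⊞-invˡ w))
               (⊞-≋ʳ (⊗-zeroʳ (⊝ w)) (from-to s')))

    bottom-left : u ⊗ 𝟏 ⊞ ⌟ H ⌞ ⊗ Sw ≋ Sw ⊗ d' ⊞ S ⊗ v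
    bottom-left = begin
      u ⊗ 𝟏 ⊞ ⌟ H ⌞ ⊗ Sw         ≈⟨ ⊞-cong (⊗-idʳ u) (≋-sym (⊗-assoc ⌟ H ⌞ S w)) ⟩
      u ⊞ (⌟ H ⌞ ⊗ S) ⊗ w        ≈⟨ ⊞-cong (≋-sym (cancelˡ S T u (to-from s')))
                                          (≋-trans (⊗-congʳ eq') (⊗-assoc S K w)) ⟩
      S ⊗ (T ⊗ u) ⊞ S ⊗ (K ⊗ w)  ≈⟨ ⊗-distribˡ S (T ⊗ u) (K ⊗ w) ⟨
      S ⊗ z                      ≈⟨ ⊗-congˡ (⊞-≋ʳ (⊞-invʳ (w ⊗ d')) ≋-refl) ⟨
      S ⊗ (w ⊗ d' ⊞ ⊝ (w ⊗ d') ⊞ z)    ≈⟨ ⊗-congˡ (⊞-assoc (w ⊗ d') (⊝ (w ⊗ d')) z) ⟩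
      S ⊗ (w ⊗ d' ⊞ v)           ≈⟨ ⊗-distribˡ S (w ⊗ d') v ⟩
      S ⊗ (w ⊗ d') ⊞ S ⊗ v       ≈⟨ ⊞-congʳ (⊗-assoc S w d') ⟨
      Sw ⊗ d' ⊞ S ⊗ v            ∎

    eq : H ⊗ to s ≋ to s ⊗ Companion (suc m) (stack d' v)
    eq = ≋-trans (blk-ext {E = H ⊗ to s} {E' = to s ⊗ blk d' (ε m) v (N m)}
      (begin
        d ⊗ 𝟏 ⊞ ⌝ H ⌜ ⊗ Sw         ≈⟨ ⊞-cong (⊗-idʳ d) (⊗-congʳ top) ⟩
        d ⊞ ε m ⊗ (S ⊗ w)          ≈⟨ ⊞-congˡ (⊗-assoc (ε m) S w) ⟨
        d ⊞ (ε m ⊗ S) ⊗ w          ≈⟨ ⊞-congˡ (⊗-congʳ first') ⟩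
        d'                         ≈⟨ ⊞-≋ˡ (⊗-idˡ d') (⊗-zeroˡ v) ⟨
        𝟏 ⊗ d' ⊞ 𝟎 ⊗ v             ∎)
      (begin
        d ⊗ 𝟎 ⊞ ⌝ H ⌜ ⊗ S          ≈⟨ ⊞-≋ʳ (⊗-zeroʳ d) (≋-trans (⊗-congʳ top) first') ⟩
        ε m                        ≈⟨ ⊞-≋ˡ (⊗-idˡ (ε m)) (⊗-zeroˡ (N m)) ⟨
        𝟏 ⊗ ε m ⊞ 𝟎 ⊗ N m          ∎)
      bottom-left
      (begin
        u ⊗ 𝟎 ⊞ ⌟ H ⌞ ⊗ S          ≈⟨ ⊞-≋ʳ (⊗-zeroʳ u) eq' ⟩
        S ⊗ (N m ⊞ w ⊗ ε m)        ≈⟨ ⊗-distribˡ S (N m) (w ⊗ ε m) ⟩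
        S ⊗ N m ⊞ S ⊗ (w ⊗ ε m)    ≈⟨ ⊞-comm (S ⊗ N m) (S ⊗ (w ⊗ ε m)) ⟩
        S ⊗ (w ⊗ ε m) ⊞ S ⊗ N m    ≈⟨ ⊞-congʳ (⊗-assoc S w (ε m)) ⟨
        Sw ⊗ ε m ⊞ S ⊗ N m         ∎))
      (⊗-congˡ {A = to s} (≋-sym (Companion-suc m d' v)))

    first : ε (suc m) ⊗ to s ≋ ε (suc m)
    first = ext λ where
      _ (inj₁ _) → trans (+-cong (*-identityˡ _) (∑-zero (ch m) λ k → zeroˡ _)) (+-identityʳ _)
      _ (inj₂ j) → trans (+-cong (zeroʳ _) (∑-zero (ch m) λ k → zeroˡ _)) (+-identityʳ _)

  ch→fin : ∀ m → El (ch m) → Fin (suc m)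
  ch→fin zero    _        = zero
  ch→fin (suc m) (inj₁ _) = zero
  ch→fin (suc m) (inj₂ i) = suc (ch→fin m i)

  fin→ch : ∀ m → Fin (suc m) → El (ch m)
  fin→ch zero    _       = tt
  fin→ch (suc m) zero    = inj₁ tt
  fin→ch (suc m) (suc i) = inj₂ (fin→ch m i)

  fin→ch→fin : ∀ m i → ch→fin m (fin→ch m i) ≡ i
  fin→ch→fin zero    zero    = ≡.refl
  fin→ch→fin (suc m) zero    = ≡.refl
  fin→ch→fin (suc m) (suc i) = ≡.cong suc (fin→ch→fin m i)

  ch→fin→ch : ∀ m i → fin→ch m (ch→fin m i) ≡ i
  ch→fin→ch zero    _        = ≡.refl
  ch→fin→ch (suc m) (inj₁ _) = ≡.refl
  ch→fin→ch (suc m) (inj₂ i) = ≡.cong inj₂ (ch→fin→ch m i)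

  Hess⇒IsHess : ∀ m (H : M (fin (suc m)) (fin (suc m))) → Hess H →
                IsHess m (mk λ i j → at H (ch→fin m i) (ch→fin m j))
  Hess⇒IsHess zero    H h = single
  Hess⇒IsHess (suc m) H h@(one , zer) = step (ext λ _ j → top m j one zer)
    (Hess⇒IsHess m (mk λ i j → at H (suc i) (suc j)) (Hess-tail {H = H} h))
    where
    top : ∀ m {H : M (fin (suc (suc m))) (fin (suc (suc m)))} (j : El (ch m)) →
          (∀ i j → toℕ j ≡ suc (toℕ i) → at H i j ≈ 1#) →
          (∀ i j → suc (toℕ i) < toℕ j → at H i j ≈ 0#) →
          at H zero (suc (ch→fin m j)) ≈ at (ε m) tt j
    top zero    j        one zer = one zero (suc zero) ≡.refl
    top (suc m) (inj₁ _) one zer = one zero (suc zero) ≡.refl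
    top (suc m) (inj₂ j) one zer = zer zero (suc (suc (ch→fin m j))) (s≤s (s≤s z≤n))

  Sim-Companion : ∀ m (H : M (fin (suc m)) (fin (suc m))) → Hess H →
                  Σ (M (ch m) 𝟙) λ v → Sim H (Companion m v)
  Sim-Companion m H h =
    let H' = mk λ i j → at H (ch→fin m i) (ch→fin m j)
        v , s , eq , _ = to-Companion m H' (Hess⇒IsHess m H h)
    in v , Sim-trans
             (Sim-relabel (ch→fin m) (fin→ch m) (fin→ch→fin m) (ch→fin→ch m) H) (sim s eq)

  -- Sums of two matrices from a class

  -- What the reduction to companion matrices asks of a set of matrices. It is used for matrices
  -- that are diagonalizable with restricted eigenvalues and for matrices with a given power equal
  -- to 1.
  record Class p : Set (c ⊔ ℓ ⊔ Level.suc p) where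
    field
      Good       : ∀ {a} → M a a → Set p
      Good-sim   : ∀ {a b} {A : M a a} {B : M b b} → Sim A B → Good A → Good B
      Good-⊠     : ∀ {a b} {A : M a a} {B : M b b} → Good A → Good B → Good (A ⊠ B)
      Good-ᵀ     : ∀ {a} {A : M a a} → Good A → Good (A ᵀ)
      Good-empty : (A : M (fin 0) (fin 0)) → Good A

    GoodSum : ∀ {a} → M a a → Set (c ⊔ ℓ ⊔ p)
    GoodSum C = Σ (M _ _) λ A → Σ (M _ _) λ B → Good A × Good B × A ⊞ B ≋ C

    GoodSum-sim : ∀ {a b} {C : M a a} {D : M b b} → Sim C D → GoodSum C → GoodSum D
    GoodSum-sim {C = C} {D} (sim s p) (A , B , gA , gB , q) =
      conjugate s A , conjugate s B ,
      Good-sim (Sim-conjugate s A) gA , Good-sim (Sim-conjugate s B) gB ,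
      (begin
        T ⊗ (A ⊗ S) ⊞ T ⊗ (B ⊗ S)  ≈⟨ ⊗-distribˡ T (A ⊗ S) (B ⊗ S) ⟨
        T ⊗ (A ⊗ S ⊞ B ⊗ S)        ≈⟨ ⊗-congˡ (⊗-distribʳ S A B) ⟨
        T ⊗ ((A ⊞ B) ⊗ S)          ≈⟨ ⊗-congˡ (⊗-congʳ q) ⟩
        T ⊗ (C ⊗ S)                ≈⟨ ⊗-congˡ p ⟩
        T ⊗ (S ⊗ D)                ≈⟨ cancelˡ T S D (from-to s) ⟩
        D                          ∎)
      where
      open ≋-Reasoning
      S = to s
      T = from s

    GoodSum-⊠ : ∀ {a b} {C : M a a} {D : M b b} → GoodSum C → GoodSum D → GoodSum (C ⊠ D)
    GoodSum-⊠ (A , B , gA , gB , p) (A' , B' , gA' , gB' , p') =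
      A ⊠ A' , B ⊠ B' , Good-⊠ gA gA' , Good-⊠ gB gB' ,
      blk-ext p (⊞-≋ˡ ≋-refl ≋-refl) (⊞-≋ˡ ≋-refl ≋-refl) p'

    GoodSum-ᵀ : ∀ {a} {C : M a a} → GoodSum C → GoodSum (C ᵀ)
    GoodSum-ᵀ (A , B , gA , gB , p) = A ᵀ , B ᵀ , Good-ᵀ gA , Good-ᵀ gB , ᵀ-cong p

  -- Reduction to companion matrices.

  module Reduction {p} (_≈?_ : Decidable _≈_) (K : Class p)
                   (companion : ∀ m v → Class.GoodSum K (Companion m v)) where
    open Class K

    all-zero? : ∀ {r} (f : Fin r → Carrier) → (∀ i → f i ≈ 0#) ⊎ ∃ λ i → ¬ (f i ≈ 0#)
    all-zero? f with Fin.all? (λ i → f i ≈? 0#)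
    ... | yes p = inj₁ p
    ... | no ¬p = inj₂ (Fin.¬∀⟶∃¬ _ _ (λ i → f i ≈? 0#) ¬p)

    mutual
      -- Recursion on the size `r` of the complement: lengthening a chain takes one vector out of
      -- it, and once a direct summand has been split off, the complement starts afresh with a chain
      -- of length 1.
      chain-GoodSum : ∀ r {m} (E : M (fin (suc m) ⊕ fin r) (fin (suc m) ⊕ fin r)) →
                      Chain E → GoodSum E
      chain-GoodSum r E ch with all-zero? (λ i → at E (inj₂ i) (inj₁ zero))
      ... | inj₂ (i , w≉0) = extend-GoodSum r E ch i w≉0
      ... | inj₁ w≈0       = invariant-GoodSum r E ch w≈0

      extend-GoodSum : ∀ r {m} (E : M (fin (suc m) ⊕ fin r) (fin (suc m) ⊕ fin r)) →
                       Chain E → ∀ i → ¬ (at E (inj₂ i) (inj₁ zero) ≈ 0#) → GoodSum E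
      extend-GoodSum (suc r) E ch i w≉0 =
        let E' , ch' , E~E' = extend E ch i w≉0
        in GoodSum-sim (Sim-sym E~E') (chain-GoodSum r E' ch')

      -- If the coupling with the complement cannot be cleared, the dual
      -- chain is longer, so continue with the transpose.
      invariant-GoodSum : ∀ r {m} (E : M (fin (suc m) ⊕ fin r) (fin (suc m) ⊕ fin r)) →
                          Chain E → (∀ i → at E (inj₂ i) (inj₁ zero) ≈ 0#) → GoodSum E
      -- Any first row for `Y` would do; zero is taken.
      invariant-GoodSum r {m} E (h , low) w≈0 with clear-rows ⌜ E ⌝ h ⌝ E ⌜ ⌟ E ⌞ (λ _ → 0#)
      ... | Y , _ , rows = GoodSum-sim (Sim-sym E~E₁) (split (all-zero? λ j → at X' (fromℕ m) j))
        where
        H = ⌜ E ⌝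
        X = ⌝ E ⌜
        C = ⌟ E ⌞

        -- The coupling left by the shear, nonzero at most in the last row.
        X' : M (fin (suc m)) (fin r)
        X' = (H ⊗ Y ⊞ X) ⊞ ⊝ (Y ⊗ C)

        X'-inject₁ : ∀ i j → at X' (inject₁ i) j ≈ 0#
        X'-inject₁ i j = trans (+-congʳ (rows i j)) (-‿inverseʳ _)

        E₁ = blk H X' 𝟎 C

        E~E₁ : Sim E E₁
        E~E₁ = Sim-trans
          (≋⇒Sim {B = blk H X 𝟎 C} (blk-ext ≋-refl ≋-refl
            (ext λ { i zero → w≈0 i ; i (suc j) → low i j }) ≋-refl))
          (Sim-shear Y (≋-sym (≋-trans (⊞-assoc (H ⊗ Y ⊞ X) (⊝ (Y ⊗ C)) (Y ⊗ C))
                                       (⊞-≋ˡ ≋-refl (⊞-invˡ (Y ⊗ C))))))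

        -- Transposition carries the ones of `H` below the diagonal; reversing the order of the
        -- chain carries them back. The last row of `X'` becomes column 0 of the lower left block of
        -- `E₂`, the one column in which a chain admits nonzero entries.
        rev : El (fin (suc m) ⊕ fin r) → El (fin (suc m) ⊕ fin r)
        rev (inj₁ i) = inj₁ (opposite i)
        rev (inj₂ i) = inj₂ i

        rev-rev : ∀ i → rev (rev i) ≡ i
        rev-rev (inj₁ i) = ≡.cong inj₁ (Fin.opposite-involutive i)
        rev-rev (inj₂ i) = ≡.refl

        E₂ : M (fin (suc m) ⊕ fin r) (fin (suc m) ⊕ fin r)
        E₂ = mk λ i j → at E₁ (rev j) (rev i)

        opposite+ : ∀ (i : Fin (suc m)) → toℕ (opposite i) ℕ.+ toℕ i ≡ m
        opposite+ i = ≡.trans (≡.cong (ℕ._+ toℕ i) (Fin.opposite-prop i))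
                              (ℕ.m∸n+n≡m (ℕ.≤-pred (Fin.toℕ<n i)))

        opposite-suc : ∀ i j → toℕ j ≡ suc (toℕ i) →
                       toℕ (opposite i) ≡ suc (toℕ (opposite j))
        opposite-suc i j p = ℕ.+-cancelʳ-≡ (toℕ i) _ _ (begin
          toℕ (opposite i) ℕ.+ toℕ i        ≡⟨ ≡.trans (opposite+ i) (≡.sym (opposite+ j)) ⟩
          toℕ (opposite j) ℕ.+ toℕ j        ≡⟨ ≡.cong (toℕ (opposite j) ℕ.+_) p ⟩
          toℕ (opposite j) ℕ.+ suc (toℕ i)  ≡⟨ ℕ.+-suc _ _ ⟩
          suc (toℕ (opposite j)) ℕ.+ toℕ i  ∎)
          where open ≡.≡-Reasoning

        opposite-< : ∀ i j → suc (toℕ i) < toℕ j →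
                     suc (toℕ (opposite j)) < toℕ (opposite i)
        opposite-< i j p = ℕ.+-cancelʳ-≤ (toℕ i) _ _ (begin
          suc (suc (toℕ (opposite j))) ℕ.+ toℕ i
            ≡⟨ ≡.trans (ℕ.+-suc _ _) (≡.cong suc (ℕ.+-suc _ _)) ⟨
          toℕ (opposite j) ℕ.+ suc (suc (toℕ i))  ≤⟨ ℕ.+-monoʳ-≤ (toℕ (opposite j)) p ⟩
          toℕ (opposite j) ℕ.+ toℕ j  ≡⟨ ≡.trans (opposite+ j) (≡.sym (opposite+ i)) ⟩
          toℕ (opposite i) ℕ.+ toℕ i  ∎)
          where open ℕ.≤-Reasoning

        E₂-Chain : Chain E₂
        E₂-Chain = ((λ i j p → proj₁ h (opposite j) (opposite i) (opposite-suc i j p))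
                 , (λ i j p → proj₂ h (opposite j) (opposite i) (opposite-< i j p)))
                 , λ i j → X'-inject₁ (opposite j) i

        split : (∀ j → at X' (fromℕ m) j ≈ 0#) ⊎ (∃ λ j → ¬ (at X' (fromℕ m) j ≈ 0#)) → GoodSum E₁
        split (inj₂ (j , x≉0)) = GoodSum-ᵀ (GoodSum-sim
          (Sim-sym (Sim-relabel rev rev rev-rev rev-rev (E₁ ᵀ)))
          (extend-GoodSum r E₂ E₂-Chain j x≉0))
        split (inj₁ x≈0) = GoodSum-sim (≋⇒Sim (blk-ext ≋-refl (ext X'≈0) ≋-refl ≋-refl))
          (GoodSum-⊠ (GoodSum-sim (Sim-sym (proj₂ H~)) (companion m (proj₁ H~))) (all-GoodSum r C))
          where
          H~ = Sim-Companion m H h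
          X'≈0 : ∀ i j → 0# ≈ at X' i j
          X'≈0 i j with view i
          ... | ‵fromℕ     = sym (x≈0 j)
          ... | ‵inject₁ i = sym (X'-inject₁ i j)

      all-GoodSum : ∀ n (C : M (fin n) (fin n)) → GoodSum C
      all-GoodSum zero    C = C , 𝟎 , Good-empty C , Good-empty 𝟎 , ext λ ()
      all-GoodSum (suc n) C = GoodSum-sim (Sim-sym (Sim-relabel e e⁻¹ e-e⁻¹ e⁻¹-e C))
        -- A single basis vector is a chain, whatever its image.
        (chain-GoodSum n {zero} _ (((λ { zero zero () }) , (λ { zero zero () })) , λ i ()))
        where
        e : El (fin 1 ⊕ fin n) → Fin (suc n)
        e (inj₁ _) = zero
        e (inj₂ i) = suc i
        e⁻¹ : Fin (suc n) → El (fin 1 ⊕ fin n)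
        e⁻¹ zero    = inj₁ zero
        e⁻¹ (suc i) = inj₂ i
        e-e⁻¹ : ∀ i → e (e⁻¹ i) ≡ i
        e-e⁻¹ zero    = ≡.refl
        e-e⁻¹ (suc i) = ≡.refl
        e⁻¹-e : ∀ i → e⁻¹ (e i) ≡ i
        e⁻¹-e (inj₁ zero) = ≡.refl
        e⁻¹-e (inj₂ i)    = ≡.refl

  -- Splitting a companion matrix

  difference-≉0 : ∀ {x y} → ¬ (x ≈ y) → ¬ (y + - x ≈ 0#)
  difference-≉0 x≉y p = x≉y (sym (x∙y⁻¹≈ε⇒x≈y _ _ p))

  -- The 1 × 1 Sylvester equation, solved by s = v / (z - x).
  solve-linear : ∀ {x z} → ¬ (x ≈ z) → ∀ v → Σ Carrier λ s → x * s + v ≈ s * z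
  solve-linear {x} {z} x≉z v = v * t , sym (begin
    v * t * z                        ≈⟨ *-congˡ z≈ ⟩
    v * t * (x + (z + - x))          ≈⟨ distribˡ _ _ _ ⟩
    v * t * x + v * t * (z + - x)    ≈⟨ +-cong (*-comm _ _) (*-assoc _ _ _) ⟩
    x * (v * t) + v * (t * (z + - x))
      ≈⟨ +-congˡ (*-congˡ (trans (*-comm _ _) (proj₂ inv))) ⟩
    x * (v * t) + v * 1#             ≈⟨ +-congˡ (*-identityʳ v) ⟩
    x * (v * t) + v                  ∎)
    where
    open ≈-Reasoning
    inv = inverse (z + - x) (difference-≉0 x≉z)
    t = proj₁ inv
    z≈ : z ≈ x + (z + - x)
    z≈ = sym (trans (x∙yz≈y∙xz x z (- x)) (trans (+-congˡ (-‿inverseʳ x)) (+-identityʳ z)))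

  -- Bidiagonal, with diagonal x, y, x, y, … and every other entry above the
  -- diagonal equal to 1, so that the 2 × 2 blocks are ( x 1 ; 0 y ).
  zig : Bool → Carrier → Carrier → ∀ m → M (ch m) (ch m)
  zig b     x y zero    = [ x ]
  zig true  x y (suc m) = blk [ x ] (ε m) 𝟎 (zig false y x m)
  zig false x y (suc m) = [ x ] ⊠ zig true y x m

  -- Opposite flags put the ones in complementary positions, and the diagonals cancel.
  zig-⊞ : ∀ b {x y x' y'} m → x + x' ≈ 0# → y + y' ≈ 0# →
          zig b x y m ⊞ zig (not b) x' y' m ≋ N m
  zig-⊞ b     zero    p q = ext λ _ _ → p
  zig-⊞ true  (suc m) p q = blk-ext (ext λ _ _ → p) (⊞-≋ˡ ≋-refl ≋-refl)
                                    (⊞-≋ˡ ≋-refl ≋-refl) (zig-⊞ false m q p)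
  zig-⊞ false (suc m) p q = blk-ext (ext λ _ _ → p) (⊞-≋ʳ ≋-refl ≋-refl)
                                    (⊞-≋ˡ ≋-refl ≋-refl) (zig-⊞ true m q p)

  -- `zig false` starts with a 1 × 1 block, so its first row is `x` times that of the identity:
  -- `ε m` is a left eigenvector.
  ε-zig : ∀ x y m → ε m ⊗ zig false x y m ≋ [ x ] ⊗ ε m
  ε-zig x y zero    = ext λ _ _ → *-comm _ _
  ε-zig x y (suc m) = ext λ where
    _ (inj₁ _) → trans (+-cong (*-comm _ _) (∑-zero (ch m) λ k → zeroˡ _)) (+-identityʳ _)
    _ (inj₂ j) → trans (+-cong (zeroʳ _) (∑-zero (ch m) λ k → zeroˡ _))
                       (trans (+-identityʳ _) (sym (zeroʳ _)))

  -- Back substitution from the last row: each row is a scalar equation whose coefficient `x` - `z`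
  -- or `y` - `z` is nonzero. `x` and `y` change places with every row.
  zig-solve : ∀ b {x y z} m → ¬ (x ≈ z) → ¬ (y ≈ z) → (u : M (ch m) 𝟙) →
              Σ (M (ch m) 𝟙) λ s → zig b x y m ⊗ s ⊞ u ≋ s ⊗ [ z ]
  zig-solve b zero x≉z y≉z u =
    let s , p = solve-linear x≉z (at u tt tt) in [ s ] , ext λ _ _ → p
  zig-solve b {x} {y} {z} (suc m) x≉z y≉z u = go b
    where
    uₕ = at u (inj₁ tt) tt
    uₜ : M (ch m) 𝟙
    uₜ = mk λ i j → at u (inj₂ i) j
    go : ∀ b → Σ (M (ch (suc m)) 𝟙) λ s → zig b x y (suc m) ⊗ s ⊞ u ≋ s ⊗ [ z ]
    go true =
      let s , p = zig-solve false m y≉z x≉z uₜ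
          t , q = solve-linear x≉z (at (ε m ⊗ s) tt tt + uₕ)
      in stack [ t ] s , ext λ where
           (inj₁ _) _ → trans (+-assoc _ _ _) q
           (inj₂ i) j → trans (+-congʳ (trans (+-congʳ (zeroˡ _)) (+-identityˡ _))) (entry p i j)
    go false =
      let s , p = zig-solve true m y≉z x≉z uₜ
          t , q = solve-linear x≉z uₕ
      in stack [ t ] s , ext λ where
           (inj₁ _) _ → trans (+-congʳ (trans (+-congˡ (∑-zero (ch m) λ k → zeroˡ _))
                                              (+-identityʳ _))) q
           (inj₂ i) j → trans (+-congʳ (trans (+-congʳ (zeroˡ _)) (+-identityˡ _))) (entry p i j)

  module _ {p} (K : Class p) where
    open Class K

    -- As `ε m` is a left eigenvector of `W` for `y`, the Sylvester equation is solved by a scalar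
    -- multiple s `ε m`, where xs + 1 = sy. The block `[ x ]` then splits off as a direct summand.
    Good-border : ∀ {x y} m (W : M (ch m) (ch m)) → ¬ (x ≈ y) → ε m ⊗ W ≋ [ y ] ⊗ ε m →
                  Good [ x ] → Good W → Good (blk [ x ] (ε m) 𝟎 W)
    Good-border {x} {y} m W x≉y eig gx gW =
      Good-sim (Sim-sym (Sim-shear {X' = 𝟎} ([ s ] ⊗ ε m) eq)) (Good-⊠ gx gW)
      where
      s = proj₁ (solve-linear x≉y 1#)
      xs+1≈sy = proj₂ (solve-linear x≉y 1#)
      eq : [ x ] ⊗ ([ s ] ⊗ ε m) ⊞ ε m ≋ 𝟎 ⊞ ([ s ] ⊗ ε m) ⊗ W
      eq = ≋-trans
        (ext λ _ j → let e = at (ε m) tt j in begin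
          x * (s * e) + e       ≈⟨ +-cong (*-assoc x s e) (*-identityˡ e) ⟨
          x * s * e + 1# * e    ≈⟨ distribʳ e (x * s) 1# ⟨
          (x * s + 1#) * e      ≈⟨ *-congʳ xs+1≈sy ⟩
          s * y * e             ≈⟨ *-assoc s y e ⟩
          s * (y * e)           ∎)
        (≋-sym (⊞-≋ʳ ≋-refl (≋-trans (⊗-assoc [ s ] (ε m) W) (⊗-congˡ {A = [ s ]} eig))))
        where open ≈-Reasoning

    -- Each 1 above the diagonal sits between the different eigenvalues `x` and `y`, so
    -- `Good-border` removes it.
    Good-zig : ∀ b {x y} m → ¬ (x ≈ y) → Good [ x ] → Good [ y ] → Good (zig b x y m)
    Good-zig b     zero    x≉y gx gy = gx
    Good-zig true  (suc m) x≉y gx gy =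
      Good-border m _ x≉y (ε-zig _ _ m) gx (Good-zig false m (x≉y ∘ sym) gy gx)
    Good-zig false (suc m) x≉y gx gy = Good-⊠ gx (Good-zig true m (x≉y ∘ sym) gy gx)

    -- With the blocks exchanged, `u` is the upper right block, and `zig-solve` clears it since `z`
    -- is not an eigenvalue of the bidiagonal block.
    Good-column : ∀ {x y z} m (u : M (ch m) 𝟙) → ¬ (x ≈ y) → ¬ (x ≈ z) → ¬ (y ≈ z) →
                  Good [ x ] → Good [ y ] → Good [ z ] → Good (blk [ z ] 𝟎 u (zig true x y m))
    Good-column m u x≉y x≉z y≉z gx gy gz =
      let s , p = zig-solve true m x≉z y≉z u
      in Good-sim (Sim-sym (Sim-trans (Sim-swap [ _ ] 𝟎 u (zig true _ _ m))
                                      (Sim-shear {X' = 𝟎} s (≋-trans p (≋-sym (⊞-≋ʳ ≋-refl ≋-refl))))))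
                  (Good-⊠ (Good-zig true m x≉y gx gy) gz)

    -- The diagonal entries chosen for a companion matrix with upper left entry `d`. `good-column`
    -- is required separately because over 𝔽₃ the entry `b₀` can be an eigenvalue of the bidiagonal
    -- block, and then `Good-column` does not apply.
    record Splitting (d : Carrier) : Set (c ⊔ ℓ ⊔ p) where
      field
        {a₀ b₀ α α'} : Carrier
        a₀+b₀≈d : a₀ + b₀ ≈ d
        a₀≉α    : ¬ (a₀ ≈ α)
        α≉α'    : ¬ (α ≈ α')
        good-a₀ : Good [ a₀ ]
        good-b₀ : Good [ b₀ ]
        good-α  : Good [ α ]
        good-α' : Good [ α' ]
        good-column : ∀ m (u : M (ch m) 𝟙) → Good (blk [ b₀ ] 𝟎 u (zig true (- α) (- α') m))

    Companion-GoodSum : (∀ d → Splitting d) → ∀ m v → GoodSum (Companion m v)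
    Companion-GoodSum split zero v =
      [ a₀ ] , [ b₀ ] , good-a₀ , good-b₀ , ext λ _ _ →
        trans a₀+b₀≈d (sym (trans (+-identityˡ _) (*-identityʳ _)))
      where open Splitting (split (at v tt tt))
    Companion-GoodSum split (suc m) v =
      -- This summand takes the 1 next to `a₀`, so the following one goes to the other: hence
      -- `zig false` here and `zig true` there.
      blk [ a₀ ] (ε m) 𝟎 (zig false α α' m) ,
      blk [ b₀ ] 𝟎 u (zig true (- α) (- α') m) ,
      Good-border m _ a₀≉α (ε-zig _ _ m) good-a₀ (Good-zig false m α≉α' good-α good-α') ,
      good-column m u ,
      ≋-trans (blk-ext {E' = blk [ d ] (ε m) u (N m)}
                (ext λ _ _ → a₀+b₀≈d) (⊞-≋ˡ ≋-refl ≋-refl) (⊞-≋ʳ ≋-refl ≋-refl)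
                (zig-⊞ false m (-‿inverseʳ α) (-‿inverseʳ α')))
        (≋-sym (≋-trans (⊞-congˡ (⊗-congʳ {A = v} {A' = stack [ d ] u} {B = ε (suc m)}
                          (ext λ { (inj₁ _) _ → refl ; (inj₂ _) _ → refl })))
                        (Companion-suc m [ d ] u)))
      where
      d = at v (inj₁ tt) tt
      u : M (ch m) 𝟙
      u = mk λ i j → at v (inj₂ i) j
      open Splitting (split d)

  -- Powers and diagonal matrices

  pow : ∀ {a} → M a a → ℕ → M a a
  pow A zero    = 𝟏
  pow A (suc k) = A ⊗ pow A k

  pow-cong : ∀ {a} {A B : M a a} → A ≋ B → ∀ k → pow A k ≋ pow B k
  pow-cong p zero    = ≋-refl
  pow-cong p (suc k) = ⊗-cong p (pow-cong p k)

  pow-intertwine : ∀ {a b} (A : M a a) (S : M a b) (B : M b b) → A ⊗ S ≋ S ⊗ B →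
                   ∀ k → pow A k ⊗ S ≋ S ⊗ pow B k
  pow-intertwine A S B p zero    = ≋-trans (⊗-idˡ S) (≋-sym (⊗-idʳ S))
  pow-intertwine A S B p (suc k) = begin
    (A ⊗ pow A k) ⊗ S  ≈⟨ ⊗-assoc A (pow A k) S ⟩
    A ⊗ (pow A k ⊗ S)  ≈⟨ ⊗-congˡ (pow-intertwine A S B p k) ⟩
    A ⊗ (S ⊗ pow B k)  ≈⟨ ⊗-assoc A S (pow B k) ⟨
    (A ⊗ S) ⊗ pow B k  ≈⟨ ⊗-congʳ p ⟩
    (S ⊗ B) ⊗ pow B k  ≈⟨ ⊗-assoc S B (pow B k) ⟩
    S ⊗ (B ⊗ pow B k)  ∎
    where open ≋-Reasoning

  pow-+ : ∀ {a} (A : M a a) m n → pow A (m ℕ.+ n) ≋ pow A m ⊗ pow A n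
  pow-+ A zero    n = ≋-sym (⊗-idˡ (pow A n))
  pow-+ A (suc m) n = ≋-trans (⊗-congˡ (pow-+ A m n)) (≋-sym (⊗-assoc A (pow A m) (pow A n)))

  pow-* : ∀ {a} (A : M a a) m n → pow A (m ℕ.* n) ≋ pow (pow A n) m
  pow-* A zero    n = ≋-refl
  pow-* A (suc m) n = ≋-trans (pow-+ A n (m ℕ.* n)) (⊗-congˡ (pow-* A m n))

  pow-𝟏 : ∀ {a} k → pow (𝟏 {a}) k ≋ 𝟏
  pow-𝟏 zero    = ≋-refl
  pow-𝟏 (suc k) = ≋-trans (⊗-idˡ (pow 𝟏 k)) (pow-𝟏 k)

  pow-⊠ : ∀ {a b} (A : M a a) (B : M b b) k → pow (A ⊠ B) k ≋ pow A k ⊠ pow B k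
  pow-⊠ A B zero    = blk-ext ≋-refl ≋-refl ≋-refl ≋-refl
  pow-⊠ {a} {b} A B (suc k) = ≋-trans (⊗-congˡ {A = A ⊠ B} (pow-⊠ A B k)) (blk-ext
    (⊞-≋ˡ ≋-refl (⊗-zeroˡ {b = b} 𝟎))
    (⊞-≋ˡ (⊗-zeroʳ A) (⊗-zeroˡ (pow B k)))
    (⊞-≋ˡ (⊗-zeroˡ (pow A k)) (⊗-zeroʳ B))
    (⊞-≋ʳ (⊗-zeroˡ {b = a} 𝟎) ≋-refl))

  pow-ᵀ : ∀ {a} (A : M a a) k → pow (A ᵀ) k ≋ (pow A k) ᵀ
  pow-ᵀ A zero    = ≋-sym ᵀ-𝟏
  pow-ᵀ A (suc k) = begin
    A ᵀ ⊗ pow (A ᵀ) k    ≈⟨ ⊗-congˡ (pow-ᵀ A k) ⟩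
    A ᵀ ⊗ (pow A k) ᵀ    ≈⟨ ᵀ-⊗ (pow A k) A ⟨
    (pow A k ⊗ A) ᵀ      ≈⟨ ᵀ-cong (pow-intertwine A A A ≋-refl k) ⟩
    (A ⊗ pow A k) ᵀ      ∎
    where open ≋-Reasoning

  -- Used over 𝔽₃: exponent 6 for the two summands, exponent 2 for the bidiagonal block of the
  -- second.
  RootsOfUnity : ℕ → Class ℓ
  RootsOfUnity k = record
    { Good       = λ A → pow A k ≋ 𝟏
    ; Good-sim   = λ {_} {_} {A} {B} (sim s p) q → begin
          pow B k                       ≈⟨ cancelˡ (from s) (to s) (pow B k) (from-to s) ⟨
          from s ⊗ (to s ⊗ pow B k)     ≈⟨ ⊗-congˡ (pow-intertwine A (to s) B p k) ⟨
          from s ⊗ (pow A k ⊗ to s)     ≈⟨ ⊗-congˡ (≋-trans (⊗-congʳ q) (⊗-idˡ (to s))) ⟩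
          from s ⊗ to s                 ≈⟨ from-to s ⟩
          𝟏                             ∎
    ; Good-⊠     = λ {_} {_} {A} {B} p q → ≋-trans (pow-⊠ A B k)
        (blk-ext p ≋-refl ≋-refl q)
    ; Good-ᵀ     = λ {_} {A} p → ≋-trans (pow-ᵀ A k) (≋-trans (ᵀ-cong p) ᵀ-𝟏)
    ; Good-empty = λ A → ext λ ()
    }
    where open ≋-Reasoning

  diag : ∀ {a} → (El a → Carrier) → M a a
  diag {a} f = mk λ i j → f i * Δ a i j

  diag-cong : ∀ {a} {f g : El a → Carrier} → (∀ i → f i ≈ g i) → diag f ≋ diag g
  diag-cong p = ext λ i j → *-congʳ (p i)

  ⊗-diag : ∀ {a b} (S : M a b) f i j → at (S ⊗ diag f) i j ≈ at S i j * f j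
  ⊗-diag {b = b} S f i j =
    trans (∑-cong b λ k → sym (*-assoc _ _ _)) (∑-Δʳ b j λ k → at S i k * f k)

  diag-⊗-diag : ∀ {a} (f g : El a → Carrier) → diag f ⊗ diag g ≋ diag (λ i → f i * g i)
  diag-⊗-diag {a} f g = ext λ i j → trans (⊗-diag (diag f) g i j) (begin
    f i * Δ a i j * g j    ≈⟨ *-assoc _ _ _ ⟩
    f i * (Δ a i j * g j)  ≈⟨ *-congˡ (commute i j) ⟩
    f i * (g i * Δ a i j)  ≈⟨ *-assoc _ _ _ ⟨
    f i * g i * Δ a i j    ∎)
    where
    open ≈-Reasoning
    commute : ∀ i j → Δ a i j * g j ≈ g i * Δ a i j
    commute i j with _≟_ {a} i j
    ... | yes ≡.refl = *-comm _ _
    ... | no  i≢j    = trans (trans (*-congʳ (Δ-≢ a i≢j)) (zeroˡ _))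
                             (sym (trans (*-congˡ (Δ-≢ a i≢j)) (zeroʳ _)))

  diag-𝟏 : ∀ {a} {f : El a → Carrier} → (∀ i → f i ≈ 1#) → diag f ≋ 𝟏
  diag-𝟏 p = ext λ i j → trans (*-congʳ (p i)) (*-identityˡ _)

  pow-diag : ∀ {a} (f : El a → Carrier) k → pow (diag f) k ≋ diag (λ i → f i ^ᶠ k)
  pow-diag f zero    = ≋-sym (diag-𝟏 λ i → refl)
  pow-diag f (suc k) =
    ≋-trans (⊗-congˡ {A = diag f} (pow-diag f k)) (diag-⊗-diag f _)

  diag-ᵀ : ∀ {a} (f : El a → Carrier) → diag f ᵀ ≋ diag f
  diag-ᵀ {a} f = ext go
    where
    go : ∀ i j → f j * Δ a j i ≈ f i * Δ a i j
    go i j with _≟_ {a} i j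
    ... | yes ≡.refl = refl
    ... | no  i≢j    = trans (trans (*-congˡ (Δ-≢ a (i≢j ∘ ≡.sym))) (zeroʳ _))
                             (sym (trans (*-congˡ (Δ-≢ a i≢j)) (zeroʳ _)))

  -- The diagonal form may live on any index set, so a direct sum of diagonal matrices needs no
  -- renumbering. `Q` restricts the eigenvalues.
  Diagonalizable : ∀ {p} (Q : Carrier → Set p) → ∀ {a} → M a a → Set (c ⊔ ℓ ⊔ p)
  Diagonalizable Q A = Σ Ix λ b → Σ (El b → Carrier) λ f → (∀ i → Q (f i)) × Sim A (diag f)

  DiagonalizableClass : ∀ {p} (Q : Carrier → Set p) → Class (c ⊔ ℓ ⊔ p)
  DiagonalizableClass Q = record
    { Good       = Diagonalizable Q
    ; Good-sim   = λ { s (b , f , q , t) → b , f , q , Sim-trans (Sim-sym s) t }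
    ; Good-⊠     = λ { (b , f , q , s) (b' , f' , q' , s') →
        b ⊕ b' , ⊎-rec f f' , ⊎-elim q q' , Sim-trans (Sim-⊠ s s') (≋⇒Sim (blk-ext
          ≋-refl (ext λ _ _ → sym (zeroʳ _)) (ext λ _ _ → sym (zeroʳ _)) ≋-refl)) }
    ; Good-ᵀ     = λ { (b , f , q , s) →
        b , f , q , Sim-trans (Sim-sym (Sim-ᵀ s)) (≋⇒Sim (diag-ᵀ f)) }
    ; Good-empty = λ A → fin 0 , (λ ()) , (λ ()) , ≋⇒Sim (ext λ ())
    }

  Diagonalizable-[] : ∀ {p} (Q : Carrier → Set p) {x} → Q x → Diagonalizable Q [ x ]
  Diagonalizable-[] Q {x} q = 𝟙 , (λ _ → x) , (λ _ → q) , ≋⇒Sim (ext λ _ _ → sym (*-identityʳ x))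

  -- The square is unipotent of the form ( 1 0 ; v 1 ), of order dividing 3.
  column-sixth-root : ∀ {a} {z} (u : M a 𝟙) (Z : M a a) → 1# + 1# + 1# ≈ 0# →
    z * z ≈ 1# → pow Z 2 ≋ 𝟏 → pow (blk [ z ] 𝟎 u Z) 6 ≋ 𝟏
  column-sixth-root {a} {z} u Z char3 z²≈1 Z²≋𝟏 =
    ≋-trans (pow-* B 3 2) (≋-trans (pow-cong square 3) cube)
    where
    open ≋-Reasoning
    B = blk [ z ] 𝟎 u Z
    L : M a 𝟙 → M (𝟙 ⊕ a) (𝟙 ⊕ a)
    L v = blk 𝟏 𝟎 v 𝟏
    v = u ⊗ [ z ] ⊞ Z ⊗ u

    square : pow B 2 ≋ L v
    square = ≋-trans (⊗-congˡ {A = B} (⊗-idʳ B)) (blk-ext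
      (⊞-≋ˡ (ext λ _ _ → z²≈1) (⊗-zeroˡ u))
      (⊞-≋ˡ (⊗-zeroʳ [ z ]) (⊗-zeroˡ Z))
      ≋-refl
      (⊞-≋ʳ (⊗-zeroʳ u) (≋-trans (⊗-congˡ {A = Z} (≋-sym (⊗-idʳ Z))) Z²≋𝟏)))

    L-⊗ : ∀ v w → L v ⊗ L w ≋ L (v ⊞ w)
    L-⊗ v w = blk-ext
      (⊞-≋ˡ (⊗-idˡ 𝟏) (⊗-zeroˡ w))
      (⊞-≋ˡ (⊗-zeroʳ 𝟏) (⊗-zeroˡ 𝟏))
      (⊞-cong (⊗-idʳ v) (⊗-idˡ w))
      (⊞-≋ʳ (⊗-zeroʳ v) (⊗-idˡ 𝟏))

    triple : ∀ x → x + (x + x) ≈ 0#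
    triple x = trans (sym (+-assoc x x x)) (trans (+-cong (+-cong 1x 1x) 1x)
      (trans (+-congʳ (sym (distribʳ x 1# 1#))) (trans (sym (distribʳ x (1# + 1#) 1#))
      (trans (*-congʳ char3) (zeroˡ x)))))
      where 1x = sym (*-identityˡ x)

    cube : pow (L v) 3 ≋ 𝟏
    cube = begin
      L v ⊗ (L v ⊗ (L v ⊗ 𝟏))  ≈⟨ ⊗-congˡ {A = L v} (⊗-congˡ {A = L v} (⊗-idʳ (L v))) ⟩
      L v ⊗ (L v ⊗ L v)        ≈⟨ ⊗-congˡ {A = L v} (L-⊗ v v) ⟩
      L v ⊗ L (v ⊞ v)          ≈⟨ L-⊗ v (v ⊞ v) ⟩
      L (v ⊞ (v ⊞ v))          ≈⟨ blk-ext ≋-refl ≋-refl (ext λ i j → triple (at v i j)) ≋-refl ⟩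
      𝟏                        ∎

  -- Minimal polynomials of diagonalizable matrices

  open MatrixOps F hiding (Σ[_]; δ)

  evalPoly : Poly → Carrier → Carrier
  evalPoly []       x = 0#
  evalPoly (a ∷ as) x = a + x * evalPoly as x

  evalCoeffs : ∀ {m} → (Fin m → Carrier) → Carrier → Carrier
  evalCoeffs {zero}  a x = 0#
  evalCoeffs {suc m} a x = a zero + x * evalCoeffs (a ∘ suc) x

  evalCoeffs-cong : ∀ {m} (a : Fin m → Carrier) {x y} → x ≈ y → evalCoeffs a x ≈ evalCoeffs a y
  evalCoeffs-cong {zero}  a p = refl
  evalCoeffs-cong {suc m} a p = +-congˡ (*-cong p (evalCoeffs-cong (a ∘ suc) p))

  evalPoly-+ᴾ : ∀ f g x → evalPoly (f +ᴾ g) x ≈ evalPoly f x + evalPoly g x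
  evalPoly-+ᴾ []      g       x = sym (+-identityˡ _)
  evalPoly-+ᴾ (a ∷ f) []      x = sym (+-identityʳ _)
  evalPoly-+ᴾ (a ∷ f) (b ∷ g) x = begin
    a + b + x * evalPoly (f +ᴾ g) x                ≈⟨ +-congˡ (*-congˡ (evalPoly-+ᴾ f g x)) ⟩
    a + b + x * (evalPoly f x + evalPoly g x)      ≈⟨ +-congˡ (distribˡ _ _ _) ⟩
    a + b + (x * evalPoly f x + x * evalPoly g x)  ≈⟨ interchange _ _ _ _ ⟩
    a + x * evalPoly f x + (b + x * evalPoly g x)  ∎
    where open ≈-Reasoning

  evalPoly-scale : ∀ a f x → evalPoly (scale a f) x ≈ a * evalPoly f x
  evalPoly-scale a []      x = sym (zeroʳ a)
  evalPoly-scale a (b ∷ f) x = begin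
    a * b + x * evalPoly (scale a f) x  ≈⟨ +-congˡ (*-congˡ (evalPoly-scale a f x)) ⟩
    a * b + x * (a * evalPoly f x)      ≈⟨ +-congˡ (x*yz≈y*xz x a _) ⟩
    a * b + a * (x * evalPoly f x)      ≈⟨ distribˡ _ _ _ ⟨
    a * (b + x * evalPoly f x)          ∎
    where open ≈-Reasoning

  evalPoly-mulLinear : ∀ a f x → evalPoly (mulLinear a f) x ≈ (x + - a) * evalPoly f x
  evalPoly-mulLinear a f x = begin
    evalPoly (mulLinear a f) x                 ≈⟨ evalPoly-+ᴾ (shift f) (scale (- a) f) x ⟩
    0# + x * evalPoly f x + evalPoly (scale (- a) f) x
      ≈⟨ +-cong (+-identityˡ _) (evalPoly-scale (- a) f x) ⟩
    x * evalPoly f x + - a * evalPoly f x      ≈⟨ distribʳ _ _ _ ⟨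
    (x + - a) * evalPoly f x                   ∎
    where open ≈-Reasoning

  evalPoly-prodLinear : ∀ {x as} → Any (x ≈_) as → evalPoly (prodLinear as) x ≈ 0#
  evalPoly-prodLinear {x} {a ∷ as} (here x≈a) = trans (evalPoly-mulLinear a (prodLinear as) x)
    (trans (*-congʳ (trans (+-congʳ x≈a) (-‿inverseʳ a))) (zeroˡ _))
  evalPoly-prodLinear {x} {a ∷ as} (there p) = trans (evalPoly-mulLinear a (prodLinear as) x)
    (trans (*-congˡ (evalPoly-prodLinear p)) (zeroʳ _))

  Monic-∷ : ∀ a f → Monic f → Monic (a ∷ f)
  Monic-∷ a (b ∷ f) m = m

  -- The shorter `g` does not reach the leading coefficient of `f`.
  Monic-+ᴾ : ∀ f g → length g < length f → Monic f →
             Monic (f +ᴾ g) × length (f +ᴾ g) ≡ length f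
  Monic-+ᴾ (a ∷ f)     []      p       m = m , ≡.refl
  Monic-+ᴾ (a ∷ [])    (d ∷ g) (s≤s ()) m
  Monic-+ᴾ (a ∷ b ∷ f) (d ∷ g) (s≤s p) m =
    let m' , l = Monic-+ᴾ (b ∷ f) g p m
    in Monic-∷ (a + d) ((b ∷ f) +ᴾ g) m' , ≡.cong suc l

  length-scale : ∀ a f → length (scale a f) ≡ length f
  length-scale a []      = ≡.refl
  length-scale a (b ∷ f) = ≡.cong suc (length-scale a f)

  Monic-mulLinear : ∀ a f → Monic f →
                    Monic (mulLinear a f) × length (mulLinear a f) ≡ suc (length f)
  Monic-mulLinear a (b ∷ f) m =
    let m' , l = Monic-+ᴾ (b ∷ f) (scale (- a) f)
                   (s≤s (ℕ.≤-reflexive (length-scale (- a) f))) m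
    in Monic-∷ (0# + - a * b) ((b ∷ f) +ᴾ scale (- a) f) m' , ≡.cong suc l

  Monic-prodLinear : ∀ as → Monic (prodLinear as) × length (prodLinear as) ≡ suc (length as)
  Monic-prodLinear []       = refl , ≡.refl
  Monic-prodLinear (a ∷ as) =
    let m , l = Monic-prodLinear as
        m' , l' = Monic-mulLinear a (prodLinear as) m
    in m' , ≡.trans l' (≡.cong suc l)

  -- Synthetic division: the coefficients of (a(x) - a(z)) / (x - z).
  quotient : ∀ {m} → Carrier → (Fin (suc m) → Carrier) → Fin m → Carrier
  quotient {suc m} z a zero    = evalCoeffs (a ∘ suc) z
  quotient {suc m} z a (suc i) = quotient z (a ∘ suc) i

  evalCoeffs-quotient : ∀ {m} z (a : Fin (suc m) → Carrier) x →
    evalCoeffs a x ≈ evalCoeffs a z + (x + - z) * evalCoeffs (quotient z a) x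
  evalCoeffs-quotient {zero} z a x = begin
    a zero + x * 0#                         ≈⟨ +-congˡ (trans (zeroʳ x) (sym (zeroʳ z))) ⟩
    a zero + z * 0#                         ≈⟨ +-identityʳ _ ⟨
    a zero + z * 0# + 0#                    ≈⟨ +-congˡ (zeroʳ _) ⟨
    a zero + z * 0# + (x + - z) * 0#        ∎
    where open ≈-Reasoning
  evalCoeffs-quotient {suc m} z a x = begin
    a zero + x * tx                    ≈⟨ +-congˡ (*-congˡ (evalCoeffs-quotient z (a ∘ suc) x)) ⟩
    a zero + x * (tz + (x + - z) * r)  ≈⟨ +-congˡ (distribˡ _ _ _) ⟩
    a zero + (x * tz + x * ((x + - z) * r))
      ≈⟨ +-congˡ (+-cong (*-congʳ x≈) (x*yz≈y*xz x (x + - z) r)) ⟩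
    a zero + ((z + (x + - z)) * tz + (x + - z) * (x * r))
      ≈⟨ +-congˡ (trans (+-congʳ (distribʳ _ _ _)) (+-assoc _ _ _)) ⟩
    a zero + (z * tz + ((x + - z) * tz + (x + - z) * (x * r)))
      ≈⟨ +-assoc _ _ _ ⟨
    a zero + z * tz + ((x + - z) * tz + (x + - z) * (x * r))
      ≈⟨ +-congˡ (distribˡ _ _ _) ⟨
    a zero + z * tz + (x + - z) * (tz + x * r) ∎
    where
    open ≈-Reasoning
    tx = evalCoeffs (a ∘ suc) x
    tz = evalCoeffs (a ∘ suc) z
    r  = evalCoeffs (quotient z (a ∘ suc)) x
    x≈ : x ≈ z + (x + - z)
    x≈ = sym (trans (x∙yz≈y∙xz z x (- z)) (trans (+-congˡ (-‿inverseʳ z)) (+-identityʳ x)))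

  -- The first coefficient of the quotient is the value of `a ∘ suc` at `z`. If it and the value of
  -- `a` vanish, so does the constant term of `a`, and the same hypotheses hold again for `a ∘ suc`.
  quotient-zero : ∀ {m} z (a : Fin (suc m) → Carrier) → evalCoeffs a z ≈ 0# →
                  (∀ i → quotient z a i ≈ 0#) → ∀ i → a i ≈ 0#
  quotient-zero {zero}  z a p q zero = trans (sym (trans (+-congˡ (zeroʳ z)) (+-identityʳ _))) p
  quotient-zero {suc m} z a p q zero =
    trans (sym (trans (+-congˡ (trans (*-congˡ (q zero)) (zeroʳ z))) (+-identityʳ _))) p
  quotient-zero {suc m} z a p q (suc i) = quotient-zero z (a ∘ suc) (q zero) (q ∘ suc) i

  *-≉0-cancel : ∀ {x y} → ¬ (x ≈ 0#) → x * y ≈ 0# → y ≈ 0#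
  *-≉0-cancel {x} {y} x≉0 xy≈0 = begin
    y            ≈⟨ *-identityˡ y ⟨
    1# * y       ≈⟨ *-congʳ (trans (*-comm z x) (proj₂ (inverse x x≉0))) ⟨
    z * x * y    ≈⟨ *-assoc z x y ⟩
    z * (x * y)  ≈⟨ *-congˡ xy≈0 ⟩
    z * 0#       ≈⟨ zeroʳ z ⟩
    0#           ∎
    where
    open ≈-Reasoning
    z = proj₁ (inverse x x≉0)

  -- Division by x - `z` keeps the other roots, since they differ from `z`, and lowers the number of
  -- coefficients by one.
  many-roots⇒zero : ∀ {m as} (a : Fin m → Carrier) → AllPairs (λ x y → ¬ (x ≈ y)) as →
                    All (λ x → evalCoeffs a x ≈ 0#) as → m ≤ length as → ∀ i → a i ≈ 0#
  many-roots⇒zero {suc m} {z ∷ as} a (z≉ ∷ distinct) (root ∷ roots) (s≤s m≤) =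
    quotient-zero z a root
      (many-roots⇒zero (quotient z a) distinct (All.zipWith quotient-root (z≉ , roots)) m≤)
    where
    quotient-root : ∀ {x} → ¬ (z ≈ x) × evalCoeffs a x ≈ 0# → evalCoeffs (quotient z a) x ≈ 0#
    quotient-root {x} (z≉x , ax≈0) = *-≉0-cancel (difference-≉0 z≉x) (begin
      (x + - z) * evalCoeffs (quotient z a) x                   ≈⟨ +-identityˡ _ ⟨
      0# + (x + - z) * evalCoeffs (quotient z a) x              ≈⟨ +-congʳ root ⟨
      evalCoeffs a z + (x + - z) * evalCoeffs (quotient z a) x  ≈⟨ evalCoeffs-quotient z a x ⟨
      evalCoeffs a x                                            ≈⟨ ax≈0 ⟩
      0#                                                        ∎)
      where open ≈-Reasoning

  module _ {n b} (A : Mat n) (f : El b → Carrier) (A~f : Sim (mk {fin n} {fin n} A) (diag f)) where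
    private
      S = to (basis A~f)
      T = from (basis A~f)

    -- One step of Horner's scheme; both evaluations of a polynomial at `A` follow by iterating it.
    horner : ∀ (E : M (fin n) (fin n)) (g : El b → Carrier) a → E ⊗ S ≋ S ⊗ diag g →
             mk (a ·ᴹ I +ᴹ A *ᴹ at E) ⊗ S ≋ S ⊗ diag (λ i → a + f i * g i)
    horner E g a p = ≋-trans (⊗-distribʳ S (mk (a ·ᴹ I)) (mk A ⊗ E)) (ext λ i j → begin
      at (mk (a ·ᴹ I) ⊗ S) i j + at ((mk A ⊗ E) ⊗ S) i j
        ≈⟨ +-cong (scalar i j) (entry rest i j) ⟩
      a * at S i j + at ((S ⊗ diag f) ⊗ diag g) i j
        ≈⟨ +-cong (*-comm _ _) (trans (⊗-diag (S ⊗ diag f) g i j) (*-congʳ (⊗-diag S f i j))) ⟩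
      at S i j * a + at S i j * f j * g j
        ≈⟨ +-congˡ (*-assoc _ _ _) ⟩
      at S i j * a + at S i j * (f j * g j)
        ≈⟨ distribˡ _ _ _ ⟨
      at S i j * (a + f j * g j)
        ≈⟨ ⊗-diag S _ i j ⟨
      at (S ⊗ diag (λ i → a + f i * g i)) i j ∎)
      where
      open ≈-Reasoning
      scalar : ∀ i j → at (mk (a ·ᴹ I) ⊗ S) i j ≈ a * at S i j
      scalar i j = trans (∑-cong (fin n) λ k → *-assoc _ _ _)
        (trans (sym (∑-*ˡ (fin n) a _)) (*-congˡ (∑-Δˡ (fin n) i _)))
      rest : (mk A ⊗ E) ⊗ S ≋ (S ⊗ diag f) ⊗ diag g
      rest = ≋-trans (⊗-assoc (mk A) E S) (≋-trans (⊗-congˡ {A = mk A} p)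
        (≋-trans (≋-sym (⊗-assoc (mk A) S (diag g))) (⊗-congʳ {B = diag g} (intertwine A~f))))

    𝟎-intertwine : 𝟎 ⊗ S ≋ S ⊗ diag (λ _ → 0#)
    𝟎-intertwine = ≋-trans (⊗-zeroˡ S)
      (ext λ i j → sym (trans (⊗-diag S (λ _ → 0#) i j) (zeroʳ _)))

    evalᴹ-intertwine : ∀ p → mk (evalᴹ p A) ⊗ S ≋ S ⊗ diag (λ i → evalPoly p (f i))
    evalᴹ-intertwine []      = 𝟎-intertwine
    evalᴹ-intertwine (a ∷ p) = horner (mk (evalᴹ p A)) _ a (evalᴹ-intertwine p)

    evalVec-intertwine : ∀ {m} (a : Fin m → Carrier) →
                         mk (evalVec a A) ⊗ S ≋ S ⊗ diag (λ i → evalCoeffs a (f i))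
    evalVec-intertwine {zero}  a = 𝟎-intertwine
    evalVec-intertwine {suc m} a =
      horner (mk (evalVec (a ∘ suc) A)) _ (a zero) (evalVec-intertwine (a ∘ suc))

    -- `S` is invertible, so it can be cancelled from `S ⊗ diag g ≋ 𝟎`.
    diag-annihilated : ∀ (E : M (fin n) (fin n)) (g : El b → Carrier) →
                       E ⊗ S ≋ S ⊗ diag g → E ≋ 𝟎 → ∀ i → g i ≈ 0#
    diag-annihilated E g p E≋𝟎 i = begin
      g i               ≈⟨ *-identityʳ _ ⟨
      g i * 1#          ≈⟨ *-congˡ (Δ-refl b i) ⟨
      at (diag g) i i   ≈⟨ entry diag≋𝟎 i i ⟩
      0#                ∎
      where
      open ≈-Reasoning
      diag≋𝟎 : diag g ≋ 𝟎
      diag≋𝟎 = ≋-trans (≋-sym (cancelˡ T S (diag g) (from-to (basis A~f))))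
        (≋-trans (⊗-congˡ {A = T} (≋-trans (≋-sym p) (≋-trans (⊗-congʳ {B = S} E≋𝟎) (⊗-zeroˡ S))))
                 (⊗-zeroʳ T))

    -- By `complete` every eigenvalue is a root, so the product annihilates `A`. By `sound` an
    -- annihilating polynomial vanishes at every member of `as`, which is too many roots for a
    -- smaller degree.
    minimalPolynomial : ∀ as → AllPairs (λ x y → ¬ (x ≈ y)) as →
      (∀ i → Any (f i ≈_) as) → All (λ x → ∃ λ i → f i ≈ x) as →
      IsMinimalPolynomial A (prodLinear as)
    minimalPolynomial as distinct complete sound = proj₁ (Monic-prodLinear as) , annihilates , minimal
      where
      annihilates : evalᴹ (prodLinear as) A ≈ᴹ O
      annihilates = entry (≋-trans (≋-sym (cancelʳ S T E (to-from (basis A~f))))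
        (≋-trans (⊗-congʳ {B = T} E⊗S≋𝟎) (⊗-zeroˡ T)))
        where
        E : M (fin n) (fin n)
        E = mk (evalᴹ (prodLinear as) A)
        E⊗S≋𝟎 : E ⊗ S ≋ 𝟎
        E⊗S≋𝟎 = ≋-trans (evalᴹ-intertwine (prodLinear as))
          (ext λ i j → trans (⊗-diag S _ i j)
            (trans (*-congˡ (evalPoly-prodLinear (complete j))) (zeroʳ _)))

      minimal : ∀ {m} → m ≤ length (prodLinear as) ∸ 1 → (a : Fin m → Carrier) →
                evalVec a A ≈ᴹ O → ∀ i → a i ≈ 0#
      minimal m≤ a a[A]≈O = many-roots⇒zero a distinct
        (All.map (λ { (i , fᵢ≈x) → trans (evalCoeffs-cong a (sym fᵢ≈x))
          (diag-annihilated (mk (evalVec a A)) _ (evalVec-intertwine a) (ext a[A]≈O) i) }) sound)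
        -- The coefficient list of `prodLinear as` is one longer than its degree, the length of
        -- `as`.
        (ℕ.≤-trans m≤ (ℕ.≤-reflexive (≡.cong (_∸ 1) (proj₂ (Monic-prodLinear as)))))

any-El? : ∀ a {p} {P : El a → Set p} → (∀ i → Dec (P i)) → Dec (∃ P)
any-El? 𝟙       P? = map′ (tt ,_) (λ { (tt , p) → p }) (P? tt)
any-El? (fin n) P? = Fin.any? P?
any-El? (a ⊕ b) P? = map′
  (⊎-rec (λ { (i , p) → inj₁ i , p }) (λ { (i , p) → inj₂ i , p }))
  (λ { (inj₁ i , p) → inj₁ (i , p) ; (inj₂ i , p) → inj₂ (i , p) })
  (any-El? a (P? ∘ inj₁) ⊎-dec any-El? b (P? ∘ inj₂))

-- Finite fields.

module Finite {c ℓ} (F : Field c ℓ) where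
  open Field F hiding (zero)
  open MatrixOps F hiding (Σ[_]; δ)
  open Matrices F
  open import Algebra.Properties.Ring ring
    using (-‿injective; -0#≈0#; -‿involutive; -‿distribˡ-*; -‿distribʳ-*; -‿+-comm;
           +-inverseˡ-unique; +-identityˡ-unique; x∙y⁻¹≈ε⇒x≈y)
  open import Algebra.Properties.Semiring.Exp semiring using (^-congʳ; ^-homo-*; ^-assocʳ)
  import Algebra.Properties.CommutativeMonoid.Sum *-commutativeMonoid as ∏

  1≉0 : ¬ (1# ≈ 0#)
  1≉0 = 0≉1 ∘ sym

  *-≉0 : ∀ {x y} → ¬ (x ≈ 0#) → ¬ (y ≈ 0#) → ¬ (x * y ≈ 0#)
  *-≉0 x≉0 y≉0 p = y≉0 (*-≉0-cancel x≉0 p)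

  -‿≉0 : ∀ {x} → ¬ (x ≈ 0#) → ¬ (- x ≈ 0#)
  -‿≉0 x≉0 p = x≉0 (-‿injective (trans p (sym -0#≈0#)))

  -- Multiplication by x permutes the nonzero elements, and so multiplies
  -- their product by both 1 and x ^ (q − 1).
  fermat : ∀ q → HasCard F q → ∀ x → ¬ (x ≈ 0#) → x ^ᶠ (q ∸ 1) ≈ 1#
  fermat zero    (e , inj , sur) x x≉0 = contradiction (proj₁ (sur x)) λ ()
  fermat (suc n) (e , inj , sur) x x≉0 =
    sym (x∙y⁻¹≈ε⇒x≈y 1# (x ^ᶠ n) (*-≉0-cancel Π≉0 (begin
      Π * (1# + - (x ^ᶠ n))          ≈⟨ distribˡ Π 1# (- (x ^ᶠ n)) ⟩
      Π * 1# + Π * - (x ^ᶠ n)        ≈⟨ +-cong (*-identityʳ Π) (sym (-‿distribʳ-* Π (x ^ᶠ n))) ⟩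
      Π + - (Π * x ^ᶠ n)             ≈⟨ +-congʳ Π≈ ⟩
      Π * x ^ᶠ n + - (Π * x ^ᶠ n)    ≈⟨ -‿inverseʳ _ ⟩
      0#                             ∎)))
    where
    open ≈-Reasoning
    idx : Carrier → Fin (suc n)
    idx = proj₁ ∘ sur
    e-idx : ∀ z → e (idx z) ≈ z
    e-idx = proj₂ ∘ sur
    y = proj₁ (inverse x x≉0)
    xy≈1 = proj₂ (inverse x x≉0)

    cancel : ∀ {u v} → u * v ≈ 1# → ∀ i → idx (u * e (idx (v * e i))) ≡ i
    cancel {u} {v} uv≈1 i = inj _ _ (begin
      e (idx (u * e (idx (v * e i))))  ≈⟨ e-idx _ ⟩
      u * e (idx (v * e i))            ≈⟨ *-congˡ (e-idx _) ⟩
      u * (v * e i)                    ≈⟨ *-assoc u v (e i) ⟨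
      u * v * e i                      ≈⟨ *-congʳ uv≈1 ⟩
      1# * e i                         ≈⟨ *-identityˡ _ ⟩
      e i                              ∎)

    π : Permutation (suc n) (suc n)
    π = permutation (λ i → idx (x * e i)) (λ i → idx (y * e i))
          (cancel xy≈1) (cancel (trans (*-comm y x) xy≈1))

    i₀ = idx 0#
    π-i₀ : π ⟨$⟩ʳ i₀ ≡ i₀
    π-i₀ = inj _ _ (trans (e-idx _) (trans (*-congˡ (e-idx 0#)) (trans (zeroʳ x) (sym (e-idx 0#)))))

    g : Fin n → Carrier
    g j = e (punchIn i₀ j)

    g≉0 : ∀ j → ¬ (g j ≈ 0#)
    g≉0 j p = Fin.punchInᵢ≢i i₀ j (inj _ _ (trans p (sym (e-idx 0#))))

    -- `π` fixes the index of 0; what remains is a permutation of the nonzero elements.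
    ρ = remove i₀ π

    g-ρ : ∀ j → g (ρ ⟨$⟩ʳ j) ≈ g j * x
    g-ρ j = trans (reflexive (≡.cong e (≡.sym (≡.trans (punchIn-permute π i₀ j)
                    (≡.cong (λ i → punchIn i (ρ ⟨$⟩ʳ j)) π-i₀)))))
                  (trans (e-idx _) (*-comm _ _))

    Π = ∏.sum g

    product-≉0 : ∀ {m} (f : Fin m → Carrier) → (∀ j → ¬ (f j ≈ 0#)) → ¬ (∏.sum f ≈ 0#)
    product-≉0 {zero}  f f≉0 = 1≉0
    product-≉0 {suc m} f f≉0 = *-≉0 (f≉0 zero) (product-≉0 (f ∘ suc) (f≉0 ∘ suc))

    Π≉0 : ¬ (Π ≈ 0#)
    Π≉0 = product-≉0 g g≉0

    Π≈ : Π ≈ Π * x ^ᶠ n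
    Π≈ = begin
      ∏.sum g                              ≈⟨ ∏.sum-permute g ρ ⟩
      ∏.sum (λ j → g (ρ ⟨$⟩ʳ j))           ≈⟨ ∏.sum-cong-≋ g-ρ ⟩
      ∏.sum (λ j → g j * x)                ≈⟨ ∏.∑-distrib-+ g (λ _ → x) ⟩
      ∏.sum g * ∏.sum {n} (λ _ → x)        ≈⟨ *-congˡ (∏.sum-replicate n) ⟩
      Π * x ^ᶠ n                           ∎

  module Card (q : ℕ) (card : HasCard F q) where
    private
      e   = proj₁ card
      inj = proj₁ (proj₂ card)
      sur = proj₂ (proj₂ card)

    _≈?_ : Decidable _≈_
    x ≈? y = map′
      (λ p → trans (sym (proj₂ (sur x))) (trans (reflexive (≡.cong e p)) (proj₂ (sur y))))
      (λ p → inj _ _ (trans (proj₂ (sur x)) (trans p (sym (proj₂ (sur y))))))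
      (proj₁ (sur x) Fin.≟ proj₁ (sur y))

    -- If each of the `q` elements occurred in `xs`, two of them would share a position, by the
    -- pigeonhole principle.
    fresh : ∀ xs → length xs < q → Σ Carrier λ x → All (λ y → ¬ (x ≈ y)) xs
    fresh xs xs<q with Fin.any? (λ i → ¬? (Any.any? (e i ≈?_) xs))
    ... | yes (i , p) = e i , ¬Any⇒All¬ xs p
    ... | no  ¬p      = contradiction (inj i j eᵢ≈eⱼ) (Fin.<⇒≢ i<j)
      where
      found : ∀ i → Any (e i ≈_) xs
      found i = decidable-stable (Any.any? (e i ≈?_) xs) (λ ¬a → ¬p (i , ¬a))
      collision = Fin.pigeonhole xs<q (λ i → Any.index (found i))
      i = proj₁ collision
      j = proj₁ (proj₂ collision)
      i<j = proj₁ (proj₂ (proj₂ collision))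
      eᵢ≈eⱼ : e i ≈ e j
      eᵢ≈eⱼ = trans (lookup-index (found i))
        (trans (reflexive (≡.cong (lookup xs) (proj₂ (proj₂ (proj₂ collision)))))
               (sym (lookup-index (found j))))

    -- For x ≠ 0, Bézout gives either ak = 1 + b(q - 1), and xᵃ is a root, or 1 + ak = b(q - 1), and
    -- the a-th power of x⁻¹ is one; `fermat` removes the multiples of q - 1.
    kth-root : ∀ {k} → 1 ≤ k → gcd k (q ∸ 1) ≡ 1 → ∀ x → Σ Carrier λ y → y ^ᶠ k ≈ x
    kth-root {suc k} _ cop x with x ≈? 0#
    ... | yes x≈0 = 0# , trans (zeroˡ _) (sym x≈0)
    ... | no  x≉0 with Bézout.identity (≡.subst (GCD (suc k) (q ∸ 1)) cop (gcd-GCD (suc k) (q ∸ 1)))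
    ... | Bézout.+- a b eq = x ^ᶠ a , (begin
      (x ^ᶠ a) ^ᶠ suc k           ≈⟨ ^-assocʳ x a (suc k) ⟩
      x ^ᶠ (a ℕ.* suc k)          ≈⟨ ^-congʳ x eq ⟨
      x * x ^ᶠ (b ℕ.* (q ∸ 1))    ≈⟨ *-congˡ (power-one b) ⟩
      x * 1#                      ≈⟨ *-identityʳ x ⟩
      x                           ∎)
      where
      open ≈-Reasoning
      power-one : ∀ b → x ^ᶠ (b ℕ.* (q ∸ 1)) ≈ 1#
      power-one zero    = refl
      power-one (suc b) = trans (^-homo-* x (q ∸ 1) (b ℕ.* (q ∸ 1)))
        (trans (*-cong (fermat q card x x≉0) (power-one b)) (*-identityˡ 1#))
    ... | Bézout.-+ a b eq = y ^ᶠ a , (begin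
      (y ^ᶠ a) ^ᶠ suc k                    ≈⟨ ^-assocʳ y a (suc k) ⟩
      y ^ᶠ (a ℕ.* suc k)                   ≈⟨ *-identityˡ _ ⟨
      1# * y ^ᶠ (a ℕ.* suc k)              ≈⟨ *-congʳ xy≈1 ⟨
      x * y * y ^ᶠ (a ℕ.* suc k)           ≈⟨ *-assoc _ _ _ ⟩
      x * y ^ᶠ (1 ℕ.+ a ℕ.* suc k)         ≈⟨ *-congˡ (^-congʳ y eq) ⟩
      x * y ^ᶠ (b ℕ.* (q ∸ 1))             ≈⟨ *-congˡ (power-one b) ⟩
      x * 1#                               ≈⟨ *-identityʳ x ⟩
      x                                    ∎)
      where
      open ≈-Reasoning
      y = proj₁ (inverse x x≉0)
      xy≈1 = proj₂ (inverse x x≉0)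
      y≉0 : ¬ (y ≈ 0#)
      y≉0 y≈0 = 0≉1 (trans (sym (zeroʳ x)) (trans (*-congˡ (sym y≈0)) xy≈1))
      power-one : ∀ b → y ^ᶠ (b ℕ.* (q ∸ 1)) ≈ 1#
      power-one zero    = refl
      power-one (suc b) = trans (^-homo-* y (q ∸ 1) (b ℕ.* (q ∸ 1)))
        (trans (*-cong (fermat q card y y≉0) (power-one b)) (*-identityˡ 1#))

    -- The eigenvalues are listed by filtering the enumeration of the field, which makes them
    -- distinct.
    Sim-diag⇒SplitSemisimple : ∀ {n b} (A : Mat n) (f : El b → Carrier) →
                               Sim (mk {fin n} {fin n} A) (diag f) → SplitSemisimple A
    Sim-diag⇒SplitSemisimple {b = b} A f A~f = eigenvalues , distinct ,
      minimalPolynomial A f A~f eigenvalues distinct complete (all-filter occurs? (tabulate e))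
      where
      occurs? : ∀ x → Dec (∃ λ i → f i ≈ x)
      occurs? x = any-El? b (λ i → f i ≈? x)
      eigenvalues = filter occurs? (tabulate e)
      distinct : AllPairs (λ x y → ¬ (x ≈ y)) eigenvalues
      distinct = AllPairs.filter⁺ occurs? (AllPairs.tabulate⁺ λ i≢j p → i≢j (inj _ _ p))
      complete : ∀ i → Any (f i ≈_) eigenvalues
      complete i = let j , p = sur (f i) in
        Any.map (λ { ≡.refl → sym p }) (∈-filter⁺ occurs? (∈-tabulate⁺ {f = e} j) (i , sym p))

  -- Roots of diagonalizable matrices.

  pow-^ᴹ : ∀ {n} (A : Mat n) k → mk (A ^ᴹ k) ≋ pow (mk {fin n} {fin n} A) k
  pow-^ᴹ A zero    = ≋-refl
  pow-^ᴹ A (suc k) = ⊗-congˡ {A = mk A} (pow-^ᴹ A k)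

  sum-of-powers : ∀ {n} k (A B : Mat n) {A' B' C : M (fin n) (fin n)} →
    pow (mk A) k ≋ A' → pow (mk B) k ≋ B' → A' ⊞ B' ≋ C → A ^ᴹ k +ᴹ B ^ᴹ k ≈ᴹ at C
  sum-of-powers k A B p q r =
    entry (≋-trans (⊞-cong (≋-trans (pow-^ᴹ A k) p) (≋-trans (pow-^ᴹ B k) q)) r)

  module _ (q k : ℕ) (card : HasCard F q) (1≤k : 1 ≤ k) (cop : gcd k (q ∸ 1) ≡ 1) where
    open Card q card

    -- The eigenvalues are replaced by k-th roots in the same basis. Invertibility is conditional on
    -- `Q` excluding 0, so that one lemma serves both (b) and (c).
    diagonalizable-root : ∀ {p} {Q : Carrier → Set p} {n} (A' : M (fin n) (fin n)) →
      Diagonalizable Q A' → Σ (Mat n) λ A →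
        SplitSemisimple A × ((∀ {x} → Q x → ¬ (x ≈ 0#)) → Invertible A) × pow (mk A) k ≋ A'
    diagonalizable-root {Q = Q} {n} A' (b , f , Qf , sim s@(iso S T ST≋𝟏 TS≋𝟏) A'S≋SD) =
      at A , Sim-diag⇒SplitSemisimple (at A) g A~g , invertible , power
      where
      open ≋-Reasoning
      g : El b → Carrier
      g i = proj₁ (kth-root 1≤k cop (f i))
      gᵏ≈f : ∀ i → g i ^ᶠ k ≈ f i
      gᵏ≈f i = proj₂ (kth-root 1≤k cop (f i))

      conj : (El b → Carrier) → M (fin n) (fin n)
      conj h = S ⊗ (diag h ⊗ T)

      A = conj g

      A~g : Sim A (diag g)
      A~g = Sim-sym (Sim-conjugate (Iso-sym s) (diag g))

      power : pow A k ≋ A'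
      power = begin
        pow A k            ≈⟨ cancelʳ S T (pow A k) ST≋𝟏 ⟨
        (pow A k ⊗ S) ⊗ T  ≈⟨ ⊗-congʳ {B = T} (pow-intertwine A S (diag g) (intertwine A~g) k) ⟩
        (S ⊗ pow (diag g) k) ⊗ T
          ≈⟨ ⊗-congʳ {B = T} (⊗-congˡ {A = S} (≋-trans (pow-diag g k) (diag-cong gᵏ≈f))) ⟩
        (S ⊗ diag f) ⊗ T   ≈⟨ ⊗-congʳ {B = T} A'S≋SD ⟨
        (A' ⊗ S) ⊗ T       ≈⟨ cancelʳ S T A' ST≋𝟏 ⟩
        A'                 ∎

      conj-inverse : ∀ h h' → (∀ i → h i * h' i ≈ 1#) → conj h ⊗ conj h' ≋ 𝟏
      conj-inverse h h' hh'≈1 = begin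
        (S ⊗ (diag h ⊗ T)) ⊗ (S ⊗ (diag h' ⊗ T))
          ≈⟨ ⊗-congʳ {B = S ⊗ (diag h' ⊗ T)} (⊗-assoc S (diag h) T) ⟨
        ((S ⊗ diag h) ⊗ T) ⊗ (S ⊗ (diag h' ⊗ T))
          ≈⟨ cancel-inner T S (S ⊗ diag h) (diag h' ⊗ T) TS≋𝟏 ⟩
        (S ⊗ diag h) ⊗ (diag h' ⊗ T)
          ≈⟨ ⊗-assoc S (diag h) (diag h' ⊗ T) ⟩
        S ⊗ (diag h ⊗ (diag h' ⊗ T))
          ≈⟨ ⊗-congˡ {A = S} (cancelˡ (diag h) (diag h') T
               (≋-trans (diag-⊗-diag h h') (diag-𝟏 hh'≈1))) ⟩
        S ⊗ T
          ≈⟨ ST≋𝟏 ⟩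
        𝟏 ∎

      invertible : (∀ {x} → Q x → ¬ (x ≈ 0#)) → Invertible (at A)
      invertible Q≉0 = at (conj g⁻¹) ,
        entry (conj-inverse g g⁻¹ (proj₂ ∘ inv)) ,
        entry (conj-inverse g⁻¹ g λ i → trans (*-comm _ _) (proj₂ (inv i)))
        where
        zero-power : ∀ {k x} → 1 ≤ k → x ≈ 0# → x ^ᶠ k ≈ 0#
        zero-power {suc k} _ x≈0 = trans (*-congʳ x≈0) (zeroˡ _)
        inv : ∀ i → Σ Carrier λ y → g i * y ≈ 1#
        inv i = inverse (g i) λ gᵢ≈0 →
          Q≉0 (Qf i) (trans (sym (gᵏ≈f i)) (zero-power 1≤k gᵢ≈0))
        g⁻¹ : El b → Carrier
        g⁻¹ = proj₁ ∘ inv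

    diagonalizable-sum : ∀ {p} {Q : Carrier → Set p} →
      (∀ d → Splitting (DiagonalizableClass Q) d) → ∀ {n} (C : Mat n) →
      Σ (Mat n) λ A → Σ (Mat n) λ B →
        (SplitSemisimple A × ((∀ {x} → Q x → ¬ (x ≈ 0#)) → Invertible A)) ×
        (SplitSemisimple B × ((∀ {x} → Q x → ¬ (x ≈ 0#)) → Invertible B)) ×
        (A ^ᴹ k +ᴹ B ^ᴹ k ≈ᴹ C)
    diagonalizable-sum {Q = Q} split {n} C =
      let A' , B' , dA , dB , sum = Reduction.all-GoodSum _≈?_ (DiagonalizableClass Q)
                                      (Companion-GoodSum (DiagonalizableClass Q) split) n (mk C)
          A , ssA , invA , powA = diagonalizable-root A' dA
          B , ssB , invB , powB = diagonalizable-root B' dB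
      in A , B , (ssA , invA) , (ssB , invB) , sum-of-powers k A B powA powB sum

  -- Here a₀ is `d + α''` and b₀ is `- α''`. The column summand then asks that `α`, `α'` and `α''`
  -- be distinct, and the other one adds that `α` differs from a₀.
  diagonal-splitting : ∀ {p} {Q : Carrier → Set p} d α α' α'' →
    Q (d + α'') → Q (- α'') → Q α → Q α' → Q (- α) → Q (- α') →
    ¬ (α ≈ α'') → ¬ (α ≈ d + α'') → ¬ (α' ≈ α'') → ¬ (α' ≈ α) →
    Splitting (DiagonalizableClass Q) d
  diagonal-splitting {Q = Q} d α α' α'' qa qb qα qα' q-α q-α' α≉α'' α≉a₀ α'≉α'' α'≉α = record
    { a₀+b₀≈d = trans (+-assoc d α'' (- α'')) (trans (+-congˡ (-‿inverseʳ α'')) (+-identityʳ d))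
    ; a₀≉α    = α≉a₀ ∘ sym
    ; α≉α'    = α'≉α ∘ sym
    ; good-a₀ = Diagonalizable-[] Q qa
    ; good-b₀ = Diagonalizable-[] Q qb
    ; good-α  = Diagonalizable-[] Q qα
    ; good-α' = Diagonalizable-[] Q qα'
    ; good-column = λ m u → Good-column (DiagonalizableClass Q) m u
        (α'≉α ∘ sym ∘ -‿injective) (α≉α'' ∘ -‿injective) (α'≉α'' ∘ -‿injective)
        (Diagonalizable-[] Q q-α) (Diagonalizable-[] Q q-α') (Diagonalizable-[] Q qb)
    }

  -- Each new element has at most two values to avoid.
  splitting-≥3 : ∀ {q} → HasCard F q → 3 ≤ q → ∀ d → Splitting (DiagonalizableClass (λ _ → ⊤)) d
  splitting-≥3 {q} card 3≤q d
    with α'' , _ ← Card.fresh q card [] (ℕ.≤-trans (s≤s z≤n) 3≤q)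
    with α , α≉α'' ∷ α≉a₀ ∷ [] ← Card.fresh q card (α'' ∷ d + α'' ∷ []) 3≤q
    with α' , α'≉α'' ∷ α'≉α ∷ [] ← Card.fresh q card (α'' ∷ α ∷ []) 3≤q
    = diagonal-splitting d α α' α'' tt tt tt tt tt tt α≉α'' α≉a₀ α'≉α'' α'≉α

  -- With 0 to be avoided as well, at most three values are excluded each time; `α''` ≠ -d keeps a₀
  -- nonzero.
  splitting-≥4 : ∀ {q} → HasCard F q → 4 ≤ q → ∀ d →
                 Splitting (DiagonalizableClass (λ x → ¬ (x ≈ 0#))) d
  splitting-≥4 {q} card 4≤q d
    with α'' , α''≉0 ∷ α''≉-d ∷ [] ← Card.fresh q card (0# ∷ - d ∷ []) (ℕ.≤-trans (s≤s (s≤s (s≤s z≤n))) 4≤q)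
    with α , α≉0 ∷ α≉α'' ∷ α≉a₀ ∷ [] ← Card.fresh q card (0# ∷ α'' ∷ d + α'' ∷ []) 4≤q
    with α' , α'≉0 ∷ α'≉α'' ∷ α'≉α ∷ [] ← Card.fresh q card (0# ∷ α'' ∷ α ∷ []) 4≤q
    = diagonal-splitting d α α' α''
        (λ p → α''≉-d (+-inverseˡ-unique α'' d (trans (+-comm α'' d) p)))
        (-‿≉0 α''≉0) α≉0 α'≉0 (-‿≉0 α≉0) (-‿≉0 α'≉0) α≉α'' α≉a₀ α'≉α'' α'≉α

  -- The field with three elements.

  module Three (card : HasCard F 3) where
    open Card 3 card

    square≈1⇒±1 : ∀ {x} → x * x ≈ 1# → (x ≈ 1#) ⊎ (x ≈ - 1#)
    square≈1⇒±1 {x} x²≈1 with x ≈? 1#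
    ... | yes x≈1 = inj₁ x≈1
    ... | no  x≉1 = inj₂ (+-inverseˡ-unique x 1# (*-≉0-cancel (difference-≉0 (x≉1 ∘ sym)) (begin
      (x + - 1#) * (x + 1#)               ≈⟨ distribʳ (x + 1#) x (- 1#) ⟩
      x * (x + 1#) + - 1# * (x + 1#)
        ≈⟨ +-cong (distribˡ x x 1#) (trans (sym (-‿distribˡ-* 1# (x + 1#))) (-‿cong (*-identityˡ _))) ⟩
      x * x + x * 1# + - (x + 1#)
        ≈⟨ +-congʳ (trans (+-cong x²≈1 (*-identityʳ x)) (+-comm 1# x)) ⟩
      x + 1# + - (x + 1#)                 ≈⟨ -‿inverseʳ _ ⟩
      0#                                  ∎)))
      where open ≈-Reasoning

    trichotomy : ∀ x → (x ≈ 0#) ⊎ (x ≈ 1#) ⊎ (x ≈ - 1#)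
    trichotomy x with x ≈? 0#
    ... | yes x≈0 = inj₁ x≈0
    ... | no  x≉0 = inj₂ (square≈1⇒±1
      (trans (*-congˡ (sym (*-identityʳ x))) (fermat 3 card x x≉0)))

    -- By `trichotomy`, 1 + 1 is 0, 1 or -1. The value 1 would give 1 = 0, and the value 0 would
    -- give 1 = -1, leaving no room for a third element.
    char3 : 1# + 1# + 1# ≈ 0#
    char3 with trichotomy (1# + 1#)
    ... | inj₂ (inj₂ 2≈-1) = trans (+-congʳ 2≈-1) (-‿inverseˡ 1#)
    ... | inj₂ (inj₁ 2≈1)  = contradiction (+-identityˡ-unique 1# 1# 2≈1) 1≉0
    ... | inj₁ 2≈0 with z , z≉0 ∷ z≉1 ∷ [] ← fresh (0# ∷ 1# ∷ []) (s≤s (s≤s (s≤s z≤n)))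
      with trichotomy z
    ... | inj₁ z≈0        = contradiction z≈0 z≉0
    ... | inj₂ (inj₁ z≈1) = contradiction z≈1 z≉1
    ... | inj₂ (inj₂ z≈-1) =
      contradiction (trans z≈-1 (sym (+-inverseˡ-unique 1# 1# 2≈0))) z≉1

    1+1≈-1 : 1# + 1# ≈ - 1#
    1+1≈-1 = +-inverseˡ-unique (1# + 1#) 1# char3

    neg-square : ∀ {x} → x * x ≈ 1# → - x * - x ≈ 1#
    neg-square {x} p = trans (sym (-‿distribˡ-* x (- x)))
      (trans (-‿cong (sym (-‿distribʳ-* x x))) (trans (-‿involutive _) p))

    [_]-square : ∀ {x} → x * x ≈ 1# → pow [ x ] 2 ≋ 𝟏
    [ p ]-square = ext λ _ _ → trans (*-congˡ (*-identityʳ _)) p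

    [_]-sixth : ∀ {x} → x * x ≈ 1# → pow [ x ] 6 ≋ 𝟏
    [_]-sixth {x} p = ≋-trans (pow-* [ x ] 3 2) (≋-trans (pow-cong [ p ]-square 3) (pow-𝟏 3))

    -- s is the first diagonal entry of A, and the others alternate in sign.
    sixth-splitting : ∀ {d s t} → s + t ≈ d → s * s ≈ 1# → t * t ≈ 1# →
                      Splitting (RootsOfUnity 6) d
    sixth-splitting {s = s} s+t≈d s²≈1 t²≈1 = record
      { a₀+b₀≈d = s+t≈d
      ; a₀≉α    = s≉-s
      ; α≉α'    = s≉-s ∘ sym
      ; good-a₀ = [ s²≈1 ]-sixth
      ; good-b₀ = [ t²≈1 ]-sixth
      ; good-α  = [ neg-square s²≈1 ]-sixth
      ; good-α' = [ s²≈1 ]-sixth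
      -- The bidiagonal block has diagonal s, -s, s, ... with s ≠ -s, so its square is 1.
      ; good-column = λ m u → column-sixth-root u _ char3 t²≈1
          (Good-zig (RootsOfUnity 2) true m (s≉-s ∘ sym ∘ -‿injective)
            [ neg-square (neg-square s²≈1) ]-square [ neg-square s²≈1 ]-square)
      }
      where
      2≉0 : ¬ (1# + 1# ≈ 0#)
      2≉0 p = -‿≉0 1≉0 (trans (sym 1+1≈-1) p)
      s≉0 : ¬ (s ≈ 0#)
      s≉0 s≈0 = 0≉1 (trans (sym (zeroˡ s)) (trans (*-congʳ (sym s≈0)) s²≈1))
      s≉-s : ¬ (s ≈ - s)
      s≉-s p = 2≉0 (*-≉0-cancel s≉0 (trans (distribˡ s 1# 1#)
        (trans (+-cong (*-identityʳ s) (trans (*-identityʳ s) p)) (-‿inverseʳ s))))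

    -- In 𝔽₃ every element is a sum of two signs: 0 = 1 + (-1), 1 = (-1) + (-1), -1 = 1 + 1.
    splitting : ∀ d → Splitting (RootsOfUnity 6) d
    splitting d with trichotomy d
    ... | inj₁ d≈0 = sixth-splitting (trans (-‿inverseʳ 1#) (sym d≈0))
                       (*-identityˡ 1#) (neg-square (*-identityˡ 1#))
    ... | inj₂ (inj₁ d≈1) = sixth-splitting
      (trans (-‿+-comm 1# 1#) (trans (-‿cong 1+1≈-1) (trans (-‿involutive 1#) (sym d≈1))))
      (neg-square (*-identityˡ 1#)) (neg-square (*-identityˡ 1#))
    ... | inj₂ (inj₂ d≈-1) = sixth-splitting (trans 1+1≈-1 (sym d≈-1))
                               (*-identityˡ 1#) (*-identityˡ 1#)

    -- As k ≡ ±1 mod 6, the k-th power of A is a k-th root of A.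
    sixth-root-root : ∀ {n k s} (A : M (fin n) (fin n)) → k ℕ.* k ≡ 1 ℕ.+ s ℕ.* 6 → pow A 6 ≋ 𝟏 →
                      Invertible (at (pow A k)) × pow (pow A k) k ≋ A
    sixth-root-root {k = k} {s} A k²≡ A⁶≋𝟏 =
      (at (pow X 5) , entry X⁶≋𝟏 ,
       entry (≋-trans (pow-intertwine X X X ≋-refl 5) X⁶≋𝟏)) ,
      (begin
        pow X k                    ≈⟨ pow-* A k k ⟨
        pow A (k ℕ.* k)            ≡⟨ ≡.cong (pow A) k²≡ ⟩
        A ⊗ pow A (s ℕ.* 6)        ≈⟨ ⊗-congˡ (pow-* A s 6) ⟩
        A ⊗ pow (pow A 6) s        ≈⟨ ⊗-congˡ (≋-trans (pow-cong A⁶≋𝟏 s) (pow-𝟏 s)) ⟩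
        A ⊗ 𝟏                      ≈⟨ ⊗-idʳ A ⟩
        A                          ∎)
      where
      open ≋-Reasoning
      X = pow A k
      X⁶≋𝟏 : pow X 6 ≋ 𝟏
      X⁶≋𝟏 = begin
        pow X 6           ≈⟨ pow-* A 6 k ⟨
        pow A (6 ℕ.* k)   ≡⟨ ≡.cong (pow A) (ℕ.*-comm 6 k) ⟩
        pow A (k ℕ.* 6)   ≈⟨ pow-* A k 6 ⟩
        pow (pow A 6) k   ≈⟨ ≋-trans (pow-cong A⁶≋𝟏 k) (pow-𝟏 k) ⟩
        𝟏                 ∎

    invertible-sum : ∀ {n k s} → k ℕ.* k ≡ 1 ℕ.+ s ℕ.* 6 → (C : Mat n) →
      Σ (Mat n) λ A → Σ (Mat n) λ B → Invertible A × Invertible B × (A ^ᴹ k +ᴹ B ^ᴹ k ≈ᴹ C)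
    invertible-sum {n} {k} {s} k²≡ C =
      let A' , B' , rA , rB , sum = Reduction.all-GoodSum _≈?_ (RootsOfUnity 6)
                                      (Companion-GoodSum (RootsOfUnity 6) splitting) n (mk C)
          invA , powA = sixth-root-root {k = k} {s} A' k²≡ rA
          invB , powB = sixth-root-root {k = k} {s} B' k²≡ rB
      in at (pow A' k) , at (pow B' k) , invA , invB , sum-of-powers k _ _ powA powB sum

-- The exponent modulo 6, and the three cases.

-- A residue prime to 6 is 1 or 5, with square 1 or 25; each witness is (k² - 1) / 6 written in
-- terms of k / 6.
square-mod-6 : ∀ k → ¬ (2 ∣ k) → ¬ (3 ∣ k) → ∃ λ s → k ℕ.* k ≡ 1 ℕ.+ s ℕ.* 6
square-mod-6 k 2∤k 3∤k with k % 6 | m≡m%n+[m/n]*n k 6 | m%n<n k 6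
... | 0 | eq | _ = contradiction (divides (3 ℕ.* (k / 6)) (≡.trans eq (even (k / 6)))) 2∤k
  where
  even : ∀ t → t ℕ.* 6 ≡ 3 ℕ.* t ℕ.* 2
  even = solve-∀
... | 1 | eq | _ = 2 ℕ.* t ℕ.+ 6 ℕ.* t ℕ.* t , ≡.trans (≡.cong₂ ℕ._*_ eq eq) (square t)
  where
  t = k / 6
  square : ∀ t → (1 ℕ.+ t ℕ.* 6) ℕ.* (1 ℕ.+ t ℕ.* 6) ≡ 1 ℕ.+ (2 ℕ.* t ℕ.+ 6 ℕ.* t ℕ.* t) ℕ.* 6
  square = solve-∀
... | 2 | eq | _ = contradiction (divides (1 ℕ.+ 3 ℕ.* (k / 6)) (≡.trans eq (even (k / 6)))) 2∤k
  where
  even : ∀ t → 2 ℕ.+ t ℕ.* 6 ≡ (1 ℕ.+ 3 ℕ.* t) ℕ.* 2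
  even = solve-∀
... | 3 | eq | _ = contradiction (divides (1 ℕ.+ 2 ℕ.* (k / 6)) (≡.trans eq (threefold (k / 6)))) 3∤k
  where
  threefold : ∀ t → 3 ℕ.+ t ℕ.* 6 ≡ (1 ℕ.+ 2 ℕ.* t) ℕ.* 3
  threefold = solve-∀
... | 4 | eq | _ = contradiction (divides (2 ℕ.+ 3 ℕ.* (k / 6)) (≡.trans eq (even (k / 6)))) 2∤k
  where
  even : ∀ t → 4 ℕ.+ t ℕ.* 6 ≡ (2 ℕ.+ 3 ℕ.* t) ℕ.* 2
  even = solve-∀
... | 5 | eq | _ = 4 ℕ.+ 10 ℕ.* t ℕ.+ 6 ℕ.* t ℕ.* t , ≡.trans (≡.cong₂ ℕ._*_ eq eq) (square t)
  where
  t = k / 6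
  square : ∀ t → (5 ℕ.+ t ℕ.* 6) ℕ.* (5 ℕ.+ t ℕ.* 6) ≡
                 1 ℕ.+ (4 ℕ.+ 10 ℕ.* t ℕ.+ 6 ℕ.* t ℕ.* t) ℕ.* 6
  square = solve-∀
... | suc (suc (suc (suc (suc (suc r))))) | _ | s≤s (s≤s (s≤s (s≤s (s≤s (s≤s ())))))

theorem1p3 :
    ∀ {c ℓ} (p l q n k : ℕ) → Prime p → q ≡ p ^ l → 2 ≤ n → 1 ≤ k →
    gcd k (q ∸ 1) ≡ 1 →
    (F : Field c ℓ) → HasCard F q →
    let open Field F
        open MatrixOps F
    in
    -- (a)
    (q ≡ 3 → ¬ (3 ∣ k) →
       ∀ (C : Mat n) → Σ (Mat n) λ A → Σ (Mat n) λ B →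
         Invertible A × Invertible B × (A ^ᴹ k +ᴹ B ^ᴹ k ≈ᴹ C))
    ×
    -- (b)
    (3 ≤ q →
       ∀ (C : Mat n) → Σ (Mat n) λ A → Σ (Mat n) λ B →
         SplitSemisimple A × SplitSemisimple B × (A ^ᴹ k +ᴹ B ^ᴹ k ≈ᴹ C))
    ×
    -- (c)
    (4 ≤ q →
       ∀ (C : Mat n) → Σ (Mat n) λ A → Σ (Mat n) λ B →
         (Invertible A × SplitSemisimple A) × (Invertible B × SplitSemisimple B) ×
         (A ^ᴹ k +ᴹ B ^ᴹ k ≈ᴹ C))
theorem1p3 p l q n k _ _ _ 1≤k cop F card = partA , partB , partC
  where
  open MatrixOps F
  open Finite F

  partA : q ≡ 3 → ¬ (3 ∣ k) → ∀ (C : Mat n) → Σ (Mat n) λ A → Σ (Mat n) λ B →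
          Invertible A × Invertible B × (A ^ᴹ k +ᴹ B ^ᴹ k ≈ᴹ C)
  partA ≡.refl 3∤k C =
    -- For q = 3, coprimality with q - 1 = 2 makes `k` odd, so `k` is prime to 6 once 3 is excluded.
    let s , k²≡ = square-mod-6 k (λ 2∣k → contradiction
                    (∣1⇒≡1 (≡.subst (2 ∣_) cop (gcd-greatest 2∣k ∣-refl))) λ ()) 3∤k
    in Three.invertible-sum card {k = k} {s} k²≡ C

  partB : 3 ≤ q → ∀ (C : Mat n) → Σ (Mat n) λ A → Σ (Mat n) λ B →
          SplitSemisimple A × SplitSemisimple B × (A ^ᴹ k +ᴹ B ^ᴹ k ≈ᴹ C)
  partB 3≤q C =
    let A , B , (ssA , _) , (ssB , _) , sum =
          diagonalizable-sum q k card 1≤k cop (splitting-≥3 card 3≤q) C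
    in A , B , ssA , ssB , sum

  partC : 4 ≤ q → ∀ (C : Mat n) → Σ (Mat n) λ A → Σ (Mat n) λ B →
          (Invertible A × SplitSemisimple A) × (Invertible B × SplitSemisimple B) ×
          (A ^ᴹ k +ᴹ B ^ᴹ k ≈ᴹ C)
  partC 4≤q C =
    let A , B , (ssA , invA) , (ssB , invB) , sum =
          diagonalizable-sum q k card 1≤k cop (splitting-≥4 card 4≤q) C
    -- Here `Q` itself says that the eigenvalue is nonzero.
    in A , B , (invA (λ x≉0 → x≉0) , ssA) , (invB (λ x≉0 → x≉0) , ssB) , sum
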